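{- Let $\mathbb{F}_q$ be a finite field with $q$ elements. Let $p, n, k$ be integers satisfying $0 < p \leq n \leq k-1$, and let $$(\lambda_1, \lambda_2, \ldots, \lambda_k) = (p+(k-1)n,\ p+(k-2)n,\ \ldots,\ p+n,\ p).$$ Let $z_1, z_2, z_3, \ldots$ be elements of $\mathbb{F}_q$ chosen uniformly and independently at random. Then the probability that $$\det\left( J_{\lambda_1, \lambda_2, \ldots, \lambda_k}(z_1, z_2, z_3, \ldots) \right) = 0$$ is $$1- \prod_{i=1}^{n} \left(1-\frac{1}{q^{i}}\right).$$
   Context: For integers $\lambda_1 \geq \lambda_2 \geq \cdots \geq \lambda_k \geq 0$, the Jacobi--Trudi matrix is the $k \times k$-matrix $$J_{\lambda_1, \ldots, \lambda_k}(z_1, z_2, z_3, \ldots) := \left( z_{\lambda_i - i + j} \right)_{1\leq i\leq k,\ 1\leq j\leq k},$$ where one sets $z_0 = 1$ and $z_m = 0$ for all $m < 0$. Only finitely many of the $z_m$ appear in the matrix, so the probability is the proportion of tuples $(z_1, \ldots, z_N) \in \mathbb{F}_q^N$ (for any sufficiently large $N$) for which the determinant vanishes. -}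

module Defs where

open import Algebra.Bundles using (CommutativeRing; Semiring)
import Algebra.Definitions as Def
import Algebra.Definitions.RawSemiring as RawSemiringDefs
open import Data.Fin.Base using (Fin; zero; suc; toℕ; punchIn)
open import Data.Fin.Properties using (inj⇒≟; nonZeroIndex)
open import Data.Integer.Base as ℤ using (ℤ; +_; +0; +[1+_]; -[1+_])
open import Data.List.Base as List using (List; []; _∷_; [_]; length; filter; cartesianProductWith; allFin)
open import Data.Nat.Base as ℕ using (ℕ; zero; suc; NonZero)
open import Data.Nat.Properties using (m^n≢0)
open import Data.Rational.Base as ℚ using (ℚ; 0ℚ; 1ℚ; +-*-rawSemiring)
open import Data.Vec.Base as Vec using (Vec)
open import Data.Vec.Functional using (Vector)
open import Function.Bundles using (Inverse)
open import Function.Properties.Inverse using (Inverse⇒Injection)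
open import Level using (Level; _⊔_) renaming (suc to lsuc)
open import Relation.Binary.Definitions using () renaming (Decidable to Decidable₂)
open import Relation.Binary.PropositionalEquality using () renaming (setoid to ≡-setoid)
open import Relation.Nullary.Negation using (¬_)
open import Relation.Unary using (Pred; Decidable)

private
  variable
    a p : Level

Matrix : Set a → ℕ → Set a
Matrix A n = Fin n → Fin n → A

record FiniteField (c ℓ : Level) (q : ℕ) : Set (lsuc (c ⊔ ℓ)) where
  field
    commutativeRing : CommutativeRing c ℓ

  open CommutativeRing commutativeRing public

  field
    0#≉1#         : ¬ (0# ≈ 1#)
    ≉0⇒invertible : ∀ {x} → ¬ (x ≈ 0#) → Def.Invertible _≈_ 1# _*_ x
    index         : Inverse setoid (≡-setoid (Fin q))

  infix 4 _≟_
  _≟_ : Decidable₂ _≈_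
  _≟_ = inj⇒≟ (Inverse⇒Injection index)

  order-nonZero : NonZero q
  order-nonZero = nonZeroIndex (Inverse.to index 0#)

  -- One representative of each ≈-class, without repetition.
  elements : List Carrier
  elements = List.map (Inverse.from index) (allFin q)

  tuples : ∀ N → List (Vec Carrier N)
  tuples zero    = [ Vec.[] ]
  tuples (suc N) = cartesianProductWith Vec._∷_ elements (tuples N)

-- Laplace expansion along the first row.
module _ {c ℓ} (R : CommutativeRing c ℓ) where
  open CommutativeRing R hiding (zero)
  open RawSemiringDefs (Semiring.rawSemiring semiring) using (sum; _^_)

  det : ∀ {n} → Matrix Carrier n → Carrier
  det {zero}  M = 1#
  det {suc n} M =
    sum λ j → (- 1#) ^ toℕ j * (M zero j * det (λ r s → M (suc r) (punchIn j s)))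

-- The subscript λᵢ - i + j; it does not change when i and j both count from 0.
subscript : ∀ {k} → Vector ℕ k → Fin k → Fin k → ℤ
subscript lam i j = + lam i ℤ.- + toℕ i ℤ.+ + toℕ j

module _ {c ℓ} (R : CommutativeRing c ℓ) where
  open CommutativeRing R

  -- A sequence z₁, z₂, … is given as a function ℕ → Carrier counting from 0,
  -- so that z m stands for z₍ₘ₊₁₎.
  entry : (ℕ → Carrier) → ℤ → Carrier
  entry z +0       = 1#
  entry z +[1+ m ] = z m
  entry z -[1+ _ ] = 0#

  jacobiTrudi : ∀ {k} → Vector ℕ k → (ℕ → Carrier) → Matrix Carrier k
  jacobiTrudi lam z i j = entry z (subscript lam i j)

  padded : ∀ {N} → Vec Carrier N → ℕ → Carrier
  padded Vec.[]       _       = 0#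
  padded (x Vec.∷ xs) zero    = x
  padded (x Vec.∷ xs) (suc m) = padded xs m

-- The value on the empty list is a dummy.
proportion : {A : Set a} {P : Pred A p} → Decidable P → List A → ℚ
proportion P? []          = 0ℚ
proportion P? xs@(_ ∷ _) = + length (filter P? xs) ℚ./ length xs

-- The probability that the determinant of the Jacobi–Trudi matrix vanishes for
-- uniform (z₁, …, z_N).  It is meaningful only if no subscript exceeds N,
-- so that the padding is never read.
singularProbability : ∀ {c ℓ q k} → FiniteField c ℓ q → Vector ℕ k → ℕ → ℚ
singularProbability F lam N =
  proportion (λ z → det commutativeRing (jacobiTrudi commutativeRing lam (padded commutativeRing z)) ≟ 0#)
             (tuples N)
  where open FiniteField F

-- (p + (k-1)n, p + (k-2)n, …, p + n, p)
arithmeticPartition : (p n k : ℕ) → Vector ℕ k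
arithmeticPartition p n k i = p ℕ.+ (k ℕ.∸ suc (toℕ i)) ℕ.* n

-- ∏_{i=1}^{n} (1 - 1/qⁱ)
eulerProduct : (q : ℕ) .{{_ : NonZero q}} → ℕ → ℚ
eulerProduct q n = product {n} λ i → 1ℚ ℚ.- ((+ 1) ℚ./ (q ℕ.^ suc (toℕ i))) {{m^n≢0 q (suc (toℕ i))}}
  where open RawSemiringDefs +-*-rawSemiring using (product)

{-# OPTIONS --safe #-}

-- Read the rows from the bottom up and put m = n + 1, k = l + m.  Each row is
-- the previous one shifted by m on its first l entries, followed by m fresh
-- uniform entries; the bottom row is nonzero but vanishes on its first l
-- entries.  Let V be the span of the rows so far, E the space of vectors
-- vanishing on the first l entries, and D = dim (V ∩ E).  If the prefix of the
-- next row is not a prefix of a vector of V, the row is independent of V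
-- whatever the fresh entries are, and D is unchanged.  Otherwise q^D of the q^m
-- choices put the row into V, and all the others raise D by one.  After the
-- bottom row D = 1, and if k independent rows are reached D = m.  The second
-- case never occurs with D = m and V proper, because V would then contain E and
-- be closed under the shift.  So the matrix is nonsingular with probability
-- ∏_{D=1}^{m-1} (1 - q^(D-m)), whatever the order of the two cases.
module Submission where

open import Defs
open import Algebra.Bundles using (CommutativeRing; RawRing; Semiring)
import Algebra.Definitions.RawSemiring as RawSemiringDefs
import Algebra.Properties.Ring as RingProperties
import Algebra.Properties.Semiring.Mult as SemiringMult
import Algebra.Solver.Ring as RingSolver
open import Algebra.Solver.Ring.AlmostCommutativeRing
  using (fromCommutativeRing; _-Raw-AlmostCommutative⟶_)
open import Data.Fin.Base as Fin using (Fin; zero; suc; toℕ; punchIn; fromℕ<)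
import Data.Fin.Permutation as Perm
import Data.Fin.Properties as Fin
open import Data.List.Base as List using (List; []; _∷_; _++_; length; tabulate; filter; cartesianProductWith)
open import Data.List.Membership.Propositional using (_∈_)
open import Data.List.Membership.Propositional.Properties using (∈-tabulate⁺; ∈-∃++)
open import Data.List.Properties using (length-tabulate; map-++; map-∘)
open import Data.List.Relation.Binary.Permutation.Propositional as ↭ using (_↭_; ↭-sym; prep; swap)
open import Data.List.Relation.Binary.Permutation.Propositional.Properties using (shift; ↭-length)
open import Data.List.Relation.Binary.Pointwise using (Pointwise; []; _∷_; Pointwise-≡⇒≡)
open import Data.List.Relation.Binary.Sublist.Heterogeneous.Properties using (toPointwise)
open import Data.List.Relation.Binary.Sublist.Propositional using (_⊆_; []; _∷_; _∷ʳ_; minimum)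
open import Data.List.Relation.Unary.All as All using (All; []; _∷_)
import Data.List.Relation.Unary.All.Properties as All
open import Data.List.Relation.Unary.Any using (here; there)
open import Data.Maybe.Base using (Maybe; just; nothing)
open import Data.Nat.Base as ℕ using (ℕ; zero; suc; _<_; _≤_; z≤n; s≤s; NonZero)
open import Data.Nat.ListAction using () renaming (sum to sumL)
open import Data.Nat.ListAction.Properties using (sum-++)
import Data.Nat.Properties as ℕ
open import Data.Nat.Solver using (module +-*-Solver)
open import Data.Product.Base using (_×_; _,_; ∃; ∃-syntax; proj₁; proj₂)
open import Data.Sum.Base using (_⊎_; inj₁; inj₂)
open import Data.Vec.Base as Vec using (Vec)
open import Function.Base using (_∘_; id)
open import Function.Bundles using (Inverse)
open import Level using (Level; _⊔_)
open import Relation.Binary.Definitions using (tri<; tri≈; tri>)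
open import Relation.Binary.PropositionalEquality as ≡ using (_≡_; module ≡-Reasoning)
open import Relation.Nullary.Decidable.Core using (Dec; yes; no; ¬?; decidable-stable)
  renaming (map′ to mapDec)
open import Relation.Nullary.Negation.Core using (¬_; contradiction)
open import Relation.Unary using (Pred; Decidable)
import Tactic.RingSolver.Core.AlmostCommutativeRing as Tactic
import Tactic.RingSolver.NonReflective as NonReflective

open import Algebra.Properties.Semiring.Sum ℕ.+-*-semiring
  using (sum; sum-cong-≗; sum-replicate-zero; ∑-distrib-+; ∑-comm; sum-permute; *-distribˡ-sum)
open +-*-Solver using ()
  renaming (solve to solveℕ; _:*_ to _⊗_; _:+_ to _⊕_; _:=_ to _⊜_; con to conℕ)

-- From one row up to the next, the subscript grows by `n` through the partition and by 1 through
-- the row index. Hence `m = n + 1`: the rows are windows of width `k`, starting at multiples of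
-- `m`, on the single sequence 0, ..., 0, 1, z₁, z₂, ....
--
-- Which rows raise D depends on the earlier choices, so no factor of the product belongs to a fixed
-- row. The count succeeds because the number of nonsingular completions depends on the rows read so
-- far only through D and the number of missing rows; the induction therefore ranges over all
-- configurations with a given D. A surviving path raises D exactly once at each value from 1 to
-- `m - 1`, and each remaining step contributes the factor 1.
--
-- Subspaces and dimensions do not occur as objects. A span is a list of generators with decidable
-- membership, V ∩ E is known through its cardinality q^D, and dimension arguments become
-- comparisons of powers of q. The link to determinants is made by minors: a dependent row kills all
-- of them, and independent rows always have a nonzero one.

-- Identities in a commutative ring.

-- Coefficients are formal differences of naturals, so that the solver can
-- cancel x against - x although equality in R is not decidable.
module DifferenceSolver {c ℓ} (R : CommutativeRing c ℓ) where
  open CommutativeRing R hiding (zero)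
  open SemiringMult semiring using (×-homo-+; ×1-homo-*) renaming (_×_ to _·_)
  open RingProperties ring using (⁻¹-anti-homo‿-; -0#≈0#; x[y-z]≈xy-xz; [y-z]x≈yx-zx)
  open import Relation.Binary.Reasoning.Setoid setoid
  private
    -- This auxiliary solver never recognises a zero, so it is given only identities that hold
    -- without cancellation; cancellations are done by hand.
    module S = NonReflective (Tactic.fromCommutativeRing R (λ _ → nothing))

  ⟦_⟧ : ℕ × ℕ → Carrier
  ⟦ a , b ⟧ = a · 1# - b · 1#

  differences : RawRing _ _
  differences = record
    { Carrier = ℕ × ℕ
    ; _≈_     = _≡_
    ; _+_     = λ (a , b) (a′ , b′) → a ℕ.+ a′ , b ℕ.+ b′
    ; _*_     = λ (a , b) (a′ , b′) → a ℕ.* a′ ℕ.+ b ℕ.* b′ , a ℕ.* b′ ℕ.+ b ℕ.* a′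
    ; -_      = λ (a , b) → b , a
    ; 0#      = 0 , 0
    ; 1#      = 1 , 0
    }

  private
    dot : ∀ a b a′ b′ → (a ℕ.* b ℕ.+ a′ ℕ.* b′) · 1# ≈ (a · 1#) * (b · 1#) + (a′ · 1#) * (b′ · 1#)
    dot a b a′ b′ = trans (×-homo-+ 1# (a ℕ.* b) (a′ ℕ.* b′)) (+-cong (×1-homo-* a b) (×1-homo-* a′ b′))

    add-sub : ∀ x y z w → (x + z) - (y + w) ≈ (x - y) + (z - w)
    add-sub = S.solve 4 (λ x y z w → ((x S.⊕ z) S.⊕ S.⊝ (y S.⊕ w)) S.⊜ ((x S.⊕ S.⊝ y) S.⊕ (z S.⊕ S.⊝ w))) refl

    mul-sub : ∀ x y z w → (x * z + y * w) - (x * w + y * z) ≈ (x - y) * (z - w)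
    mul-sub x y z w = begin
      (x * z + y * w) - (x * w + y * z)      ≈⟨ add-sub (x * z) (x * w) (y * w) (y * z) ⟩
      (x * z - x * w) + (y * w - y * z)      ≈⟨ +-congˡ (⁻¹-anti-homo‿- (y * z) (y * w)) ⟨
      (x * z - x * w) - (y * z - y * w)      ≈⟨ +-cong (x[y-z]≈xy-xz x z w) (-‿cong (x[y-z]≈xy-xz y z w)) ⟨
      x * (z - w) - y * (z - w)              ≈⟨ [y-z]x≈yx-zx (z - w) x y ⟨
      (x - y) * (z - w)                      ∎

    sub-≈ : ∀ x y z w → x + w ≈ z + y → x - y ≈ z - w
    sub-≈ x y z w eq = begin
      x - y                    ≈⟨ +-congʳ (+-identityʳ x) ⟨
      (x + 0#) - y             ≈⟨ +-congʳ (+-congˡ (-‿inverseʳ w)) ⟨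
      (x + (w - w)) - y        ≈⟨ +-congʳ (+-assoc x w (- w)) ⟨
      ((x + w) - w) - y        ≈⟨ +-congʳ (+-congʳ eq) ⟩
      ((z + y) - w) - y        ≈⟨ rearrange z y (- w) (- y) ⟩
      (z - w) + (y - y)        ≈⟨ +-congˡ (-‿inverseʳ y) ⟩
      (z - w) + 0#             ≈⟨ +-identityʳ (z - w) ⟩
      z - w                    ∎
      where
      rearrange : ∀ a b c d → ((a + b) + c) + d ≈ (a + c) + (b + d)
      rearrange = S.solve 4 (λ a b c d → (((a S.⊕ b) S.⊕ c) S.⊕ d) S.⊜ ((a S.⊕ c) S.⊕ (b S.⊕ d))) refl

  morphism : differences -Raw-AlmostCommutative⟶ fromCommutativeRing R
  morphism = record
    { ⟦_⟧    = ⟦_⟧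
    ; +-homo = λ (a , b) (a′ , b′) →
        trans (+-cong (×-homo-+ 1# a a′) (-‿cong (×-homo-+ 1# b b′))) (add-sub _ _ _ _)
    ; *-homo = λ (a , b) (a′ , b′) →
        trans (+-cong (dot a a′ b b′) (-‿cong (dot a b′ b a′))) (mul-sub _ _ _ _)
    ; -‿homo = λ (a , b) → sym (⁻¹-anti-homo‿- (a · 1#) (b · 1#))
    ; 0-homo = -‿inverseʳ 0#
    ; 1-homo = trans (sub-≈ (1 · 1#) 0# 1# 0# (+-congʳ (+-identityʳ 1#)))
                      (trans (+-congˡ -0#≈0#) (+-identityʳ 1#))
    }

  -- Cross addition in the naturals is sound but not complete: coefficients that agree only modulo
  -- the characteristic count as different.
  equal? : ∀ (p q : ℕ × ℕ) → Maybe (⟦ p ⟧ ≈ ⟦ q ⟧)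
  equal? (a , b) (a′ , b′) with (a ℕ.+ b′) ℕ.≟ (a′ ℕ.+ b)
  ... | yes eq = just (sub-≈ _ _ _ _ (begin
    a · 1# + b′ · 1#   ≈⟨ ×-homo-+ 1# a b′ ⟨
    (a ℕ.+ b′) · 1#    ≡⟨ ≡.cong (_· 1#) eq ⟩
    (a′ ℕ.+ b) · 1#    ≈⟨ ×-homo-+ 1# a′ b ⟩
    a′ · 1# + b · 1#   ∎))
  ... | no  _  = nothing

  open RingSolver differences (fromCommutativeRing R) morphism equal? public
    using (solve; _:=_; _:+_; _:*_; _:-_; :-_)

-- Alternating sums, minors and row operations.

module LinearAlgebra {c ℓ q} (F : FiniteField c ℓ q) where
  open FiniteField F hiding (zero; refl; trans; sym)
  private module K = FiniteField F
  open DifferenceSolver commutativeRing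
  open import Relation.Binary.Reasoning.Setoid setoid
  open import Algebra.Properties.Ring ring using (-1*x≈-x; -‿distribʳ-*)

  -- Infinite sequences can be shifted, and read at the widths `W` and `l`, without a change of
  -- type.
  Seq : Set c
  Seq = ℕ → Carrier

  infix 4 _≐[_]_
  _≐[_]_ : Seq → ℕ → Seq → Set ℓ
  u ≐[ W ] v = ∀ {j} → j < W → u j ≈ v j

  ≐-cases : ∀ {W} u v → u 0 ≈ v 0 → (∀ j → u (suc j) ≈ v (suc j)) → u ≐[ W ] v
  ≐-cases u v head tail {zero}  _ = head
  ≐-cases u v head tail {suc j} _ = tail j

  -- The signed sum of a Laplace expansion, over a list of column indices; the
  -- summand receives the chosen column and the remaining ones.
  alt : List ℕ → (ℕ → List ℕ → Carrier) → Carrier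
  alt []       f = 0#
  alt (x ∷ xs) f = f x xs - alt xs (λ y ys → f y (x ∷ ys))

  -- Lists of different lengths give 0, since `alt` over no columns is 0 and so is the second
  -- clause; the identities for minors thus hold for arbitrary lists.
  minor : List Seq → List ℕ → Carrier
  minor []      []      = 1#
  minor []      (_ ∷ _) = 0#
  minor (r ∷ R) cs      = alt cs λ j js → r j * minor R js

  alt-cong-All : ∀ {p} {P : ℕ → Set p} {cs} {f g : ℕ → List ℕ → Carrier} → All P cs →
                 (∀ {x xs} → P x → All P xs → f x xs ≈ g x xs) → alt cs f ≈ alt cs g
  alt-cong-All []         eq = K.refl
  alt-cong-All (px ∷ pxs) eq =
    +-cong (eq px pxs) (-‿cong (alt-cong-All pxs λ py pys → eq py (px ∷ pys)))

  alt-cong : ∀ cs {f g : ℕ → List ℕ → Carrier} → (∀ x xs → f x xs ≈ g x xs) → alt cs f ≈ alt cs g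
  alt-cong []       eq = K.refl
  alt-cong (x ∷ xs) eq = +-cong (eq x xs) (-‿cong (alt-cong xs λ y ys → eq y (x ∷ ys)))

  alt-+ : ∀ cs (f g : ℕ → List ℕ → Carrier) → alt cs (λ x xs → f x xs + g x xs) ≈ alt cs f + alt cs g
  alt-+ []       f g = K.sym (+-identityˡ 0#)
  alt-+ (x ∷ xs) f g = K.trans (+-congˡ (-‿cong (alt-+ xs _ _)))
    (solve 4 (λ a b c d → (a :+ b) :- (c :+ d) := (a :- c) :+ (b :- d)) K.refl _ _ _ _)

  alt-* : ∀ cs a (f : ℕ → List ℕ → Carrier) → alt cs (λ x xs → a * f x xs) ≈ a * alt cs f
  alt-* []       a f = K.sym (zeroʳ a)
  alt-* (x ∷ xs) a f = K.trans (+-congˡ (-‿cong (alt-* xs a _)))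
    (solve 3 (λ a b c → a :* b :- a :* c := a :* (b :- c)) K.refl _ _ _)

  alt-- : ∀ cs (f g : ℕ → List ℕ → Carrier) → alt cs (λ x xs → f x xs - g x xs) ≈ alt cs f - alt cs g
  alt-- []       f g = K.sym (-‿inverseʳ 0#)
  alt-- (x ∷ xs) f g = K.trans (+-congˡ (-‿cong (alt-- xs _ _)))
    (solve 4 (λ a b c d → (a :- b) :- (c :- d) := (a :- c) :- (b :- d)) K.refl _ _ _ _)

  alt-0 : ∀ cs {f : ℕ → List ℕ → Carrier} → (∀ x xs → f x xs ≈ 0#) → alt cs f ≈ 0#
  alt-0 []       eq = K.refl
  alt-0 (x ∷ xs) eq = K.trans (+-cong (eq x xs) (-‿cong (alt-0 xs λ y ys → eq y (x ∷ ys)))) (-‿inverseʳ 0#)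

  minor-cong : ∀ {W R R′ cs} → Pointwise _≐[ W ]_ R R′ → All (_< W) cs → minor R cs ≈ minor R′ cs
  minor-cong {cs = []}    []       _    = K.refl
  minor-cong {cs = _ ∷ _} []       _    = K.refl
  minor-cong              (e ∷ es) cs<W =
    alt-cong-All cs<W λ j<W js<W → *-cong (e j<W) (minor-cong es js<W)

  -- In a double expansion, choosing x before y and y before x carry opposite signs, so symmetric
  -- summands cancel in pairs.
  alt-symmetric : ∀ cs (g : ℕ → ℕ → List ℕ → Carrier) → (∀ x y zs → g x y zs ≈ g y x zs) →
                  alt cs (λ x xs → alt xs (g x)) ≈ 0#
  alt-symmetric []       g sy = K.refl
  alt-symmetric (x ∷ xs) g sy = begin
    alt xs (g x) - alt xs (λ y ys → g y x ys - alt ys (λ z zs → g y z (x ∷ zs)))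
      ≈⟨ +-congˡ (-‿cong (alt-- xs _ _)) ⟩
    alt xs (g x) - (alt xs (λ y ys → g y x ys) - alt xs (λ y ys → alt ys (λ z zs → g y z (x ∷ zs))))
      ≈⟨ +-congˡ (-‿cong (+-cong (alt-cong xs λ y ys → sy y x ys)
           (-‿cong (alt-symmetric xs (λ y z zs → g y z (x ∷ zs)) λ y z zs → sy y z (x ∷ zs))))) ⟩
    alt xs (g x) - (alt xs (g x) - 0#)
      ≈⟨ solve 2 (λ a b → a :- (a :- b) := b) K.refl _ _ ⟩
    0# ∎

  minor-two-rows : ∀ r s R cs → minor (r ∷ s ∷ R) cs ≈ alt cs (λ x xs → alt xs λ y ys → r x * (s y * minor R ys))
  minor-two-rows r s R cs = alt-cong cs λ x xs → K.sym (alt-* xs (r x) _)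

  -- The sum of the two minors has a summand symmetric in the two chosen columns, so `alt-symmetric`
  -- makes it vanish.
  minor-swap-rows : ∀ r s R cs → minor (r ∷ s ∷ R) cs ≈ - minor (s ∷ r ∷ R) cs
  minor-swap-rows r s R cs = begin
    minor (r ∷ s ∷ R) cs
      ≈⟨ solve 2 (λ a b → a := (a :+ b) :- b) K.refl _ _ ⟩
    (minor (r ∷ s ∷ R) cs + minor (s ∷ r ∷ R) cs) - minor (s ∷ r ∷ R) cs
      ≈⟨ +-congʳ (+-cong (minor-two-rows r s R cs) (minor-two-rows s r R cs)) ⟩
    (alt cs (λ x xs → alt xs λ y ys → r x * (s y * minor R ys)) +
     alt cs (λ x xs → alt xs λ y ys → s x * (r y * minor R ys))) - minor (s ∷ r ∷ R) cs
      ≈⟨ +-congʳ (alt-+ cs _ _) ⟨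
    alt cs (λ x xs → alt xs (λ y ys → r x * (s y * minor R ys)) +
                     alt xs (λ y ys → s x * (r y * minor R ys))) - minor (s ∷ r ∷ R) cs
      ≈⟨ +-congʳ (alt-cong cs λ x xs → K.sym (alt-+ xs _ _)) ⟩
    alt cs (λ x xs → alt xs λ y ys → r x * (s y * minor R ys) + s x * (r y * minor R ys)) - minor (s ∷ r ∷ R) cs
      ≈⟨ +-congʳ (alt-symmetric cs _ λ x y zs →
           solve 5 (λ a b c d e → a :* (b :* e) :+ c :* (d :* e) := d :* (c :* e) :+ b :* (a :* e)) K.refl _ _ _ _ _) ⟩
    0# - minor (s ∷ r ∷ R) cs
      ≈⟨ +-identityˡ _ ⟩
    - minor (s ∷ r ∷ R) cs ∎

  negate-zero : ∀ {x} → x ≈ 0# → - x ≈ 0#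
  negate-zero {x} x≈0 = K.trans (-‿cong x≈0) (K.trans (K.sym (+-identityˡ _)) (-‿inverseʳ 0#))

  scale-zero : ∀ a {x} → x ≈ 0# → a * x ≈ 0#
  scale-zero a x≈0 = K.trans (*-congˡ x≈0) (zeroʳ a)

  -- Antisymmetry alone would not do in characteristic 2, so two equal top rows are treated by
  -- `alt-symmetric`; a swap reduces the other cases to this one.
  minor-repeated-row : ∀ {s R} → s ∈ R → ∀ cs → minor (s ∷ R) cs ≈ 0#
  minor-repeated-row {s} {_ ∷ R} (here ≡.refl) cs = K.trans (minor-two-rows s s R cs)
    (alt-symmetric cs _ λ x y zs → solve 3 (λ a b c → a :* (b :* c) := b :* (a :* c)) K.refl _ _ _)
  minor-repeated-row {s} {r ∷ R} (there s∈R) cs = K.trans (minor-swap-rows s r R cs)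
    (negate-zero (alt-0 cs λ j js → scale-zero (r j) (minor-repeated-row s∈R js)))

  -- Linear spans and dependence.

  -- Rows are infinite sequences of which only the first W entries matter.
  data Span (W : ℕ) : List Seq → Seq → Set (c ⊔ ℓ) where
    []  : ∀ {v} → v ≐[ W ] (λ _ → 0#) → Span W [] v
    sub : ∀ {r R v} t → Span W R (λ j → v j - t * r j) → Span W (r ∷ R) v

  span-resp : ∀ {W R u v} → u ≐[ W ] v → Span W R u → Span W R v
  span-resp e ([] u≐0)  = [] λ j<W → K.trans (K.sym (e j<W)) (u≐0 j<W)
  span-resp e (sub t s) = sub t (span-resp (λ j<W → +-congʳ (e j<W)) s)

  span-weaken : ∀ {W R v} r → Span W R v → Span W (r ∷ R) v
  span-weaken r s = sub 0# (span-resp (λ _ → K.sym (K.trans (+-congˡ (negate-zero (zeroˡ _))) (+-identityʳ _))) s)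

  span-0 : ∀ {W} R {v} → v ≐[ W ] (λ _ → 0#) → Span W R v
  span-0 []      v≐0 = [] v≐0
  span-0 (r ∷ R) v≐0 = span-weaken r (span-0 R v≐0)

  span-head : ∀ {W} r R → Span W (r ∷ R) r
  span-head r R = sub 1# (span-0 R λ _ → K.trans (+-congˡ (-‿cong (*-identityˡ _))) (-‿inverseʳ _))

  span-+* : ∀ {W R u v} a → Span W R u → Span W R v → Span W R (λ j → u j + a * v j)
  span-+* a ([] u≐0) ([] v≐0)   =
    [] λ j<W → K.trans (+-cong (u≐0 j<W) (scale-zero a (v≐0 j<W))) (+-identityˡ 0#)
  span-+* a (sub t s) (sub t′ s′) = sub (t + a * t′) (span-resp
    (λ _ → solve 6 (λ a t t′ u v r → (u :- t :* r) :+ a :* (v :- t′ :* r) := (u :+ a :* v) :- (t :+ a :* t′) :* r)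
                   K.refl _ _ _ _ _ _)
    (span-+* a s s′))

  span-* : ∀ {W R v} a → Span W R v → Span W R (λ j → a * v j)
  span-* {R = R} a s = span-resp (λ _ → +-identityˡ _) (span-+* a (span-0 R λ _ → K.refl) s)

  span-- : ∀ {W R u v} → Span W R u → Span W R v → Span W R (λ j → u j - v j)
  span-- s s′ = span-resp (λ _ → +-congˡ (-1*x≈-x _)) (span-+* (- 1#) s s′)

  span-narrow : ∀ {W W′ R v} → W′ ≤ W → Span W R v → Span W′ R v
  span-narrow W′≤W ([] v≐0)  = [] λ j<W′ → v≐0 (ℕ.<-≤-trans j<W′ W′≤W)
  span-narrow W′≤W (sub t s) = sub t (span-narrow W′≤W s)

  -- Keeping the coefficients and evaluating the combination at all columns lifts a prefix to a
  -- vector in the span at every width.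
  span-extend : ∀ {W R v} → Span W R v → ∃[ u ] u ≐[ W ] v × (∀ W′ → Span W′ R u)
  span-extend ([] v≐0) = (λ _ → 0#) , (λ j<W → K.sym (v≐0 j<W)) , λ _ → [] λ _ → K.refl
  span-extend {R = r ∷ _} (sub t s) =
    let u , u≐ , su = span-extend s
    in  (λ j → u j + t * r j)
      , (λ j<W → K.trans (+-congʳ (u≐ j<W)) (solve 2 (λ a b → (a :- b) :+ b := a) K.refl _ _))
      , (λ W′ → sub t (span-resp (λ _ → solve 2 (λ a b → a := (a :+ b) :- b) K.refl _ _) (su W′)))

  from-to : ∀ x → Inverse.from index (Inverse.to index x) ≈ x
  from-to x = Inverse.strictlyInverseʳ index x

  -- Decided by exhaustive search over the finitely many coefficients instead of by elimination.
  span? : ∀ W R v → Dec (Span W R v)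
  span? W [] v = mapDec (λ v≐0 → [] (λ {j} → v≐0 {j})) (λ { ([] v≐0) {j} → v≐0 {j} }) (ℕ.allUpTo? (λ j → v j ≟ 0#) W)
  span? W (r ∷ R) v = mapDec
    (λ (i , s) → sub (Inverse.from index i) s)
    (λ { (sub t s) → Inverse.to index t , span-resp (λ _ → +-congˡ (-‿cong (*-congʳ (K.sym (from-to t))))) s })
    (Fin.any? λ i → span? W R (λ j → v j - Inverse.from index i * r j))

  -- The expansion is linear in the top row. The generators `R′` are separate from the lower rows
  -- `R`, so that the induction can shrink the former and keep the latter.
  minor-top-span : ∀ {W R R′ r cs} → All (_< W) cs → All (λ s → minor (s ∷ R) cs ≈ 0#) R′ →
                   Span W R′ r → minor (r ∷ R) cs ≈ 0#
  minor-top-span {R = R} {cs = cs} cs<W [] ([] r≐0) =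
    K.trans (alt-cong-All cs<W λ {_} {js} j<W _ → K.trans (*-congʳ (r≐0 j<W)) (zeroˡ (minor R js))) (alt-0 cs λ _ _ → K.refl)
  minor-top-span {R = R} {r = r} {cs} cs<W (_∷_ {b} eb es) (sub t s) = begin
    minor (r ∷ R) cs
      ≈⟨ alt-cong cs (λ j js → solve 4 (λ r b t d → r :* d := (r :- t :* b) :* d :+ t :* (b :* d)) K.refl
                                       (r j) (b j) t (minor R js)) ⟩
    alt cs (λ j js → (r j - t * b j) * minor R js + t * (b j * minor R js))
      ≈⟨ K.trans (alt-+ cs _ _) (+-congˡ (alt-* cs t _)) ⟩
    minor ((λ j → r j - t * b j) ∷ R) cs + t * minor (b ∷ R) cs
      ≈⟨ +-cong (minor-top-span {R = R} cs<W es s) (scale-zero t eb) ⟩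
    0# + 0#
      ≈⟨ +-identityˡ 0# ⟩
    0# ∎

  minor-dependent : ∀ {W R r cs} → All (_< W) cs → Span W R r → minor (r ∷ R) cs ≈ 0#
  minor-dependent {R = R} {cs = cs} cs<W = minor-top-span {R = R} cs<W (All.tabulate λ s∈R → minor-repeated-row s∈R cs)

  -- Column permutations and bordered minors.

  -- Read off the derivation and not the lists: with a repeated column, the same two lists admit
  -- derivations of both signs.
  sign : ∀ {cs ds : List ℕ} → cs ↭ ds → Carrier
  sign ↭.refl         = 1#
  sign (prep _ p)     = sign p
  sign (swap _ _ p)   = - sign p
  sign (↭.trans p p′) = sign p′ * sign p

  -- A swap exchanges the first two terms, whose signs differ. Every later term keeps its place and
  -- takes the sign from its list of remaining columns, which the hypothesis on `f` provides.
  alt-↭ : ∀ {cs ds} (p : cs ↭ ds) (f : ℕ → List ℕ → Carrier) →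
          (∀ x {xs ys} (p : xs ↭ ys) → f x ys ≈ sign p * f x xs) → alt ds f ≈ sign p * alt cs f
  alt-↭ ↭.refl f eq = K.sym (*-identityˡ _)
  alt-↭ (prep x p) f eq = K.trans
    (+-cong (eq x p) (-‿cong (alt-↭ p (λ y ys → f y (x ∷ ys)) λ y p′ → eq y (prep x p′))))
    (solve 3 (λ a b c → a :* b :- a :* c := a :* (b :- c)) K.refl _ _ _)
  alt-↭ {cs = _ ∷ _ ∷ xs} {_ ∷ _ ∷ ys} (swap x y p) f eq = begin
    f y (x ∷ ys) - (f x (y ∷ ys) - alt ys (λ z zs → f z (y ∷ x ∷ zs)))
      ≈⟨ +-cong (eq y (prep x p)) (-‿cong (+-cong (eq x (prep y p)) (-‿cong
           (alt-cong ys λ z zs → K.trans (eq z (swap x y ↭.refl)) (-1*x≈-x _))))) ⟩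
    sign p * f y (x ∷ xs) - (sign p * f x (y ∷ xs) - alt ys (λ z zs → - f z (x ∷ y ∷ zs)))
      ≈⟨ +-congˡ (-‿cong (+-congˡ (-‿cong
           (alt-↭ p (λ z zs → - f z (x ∷ y ∷ zs)) λ z p′ →
             K.trans (-‿cong (eq z (prep x (prep y p′)))) (-‿distribʳ-* _ _))))) ⟩
    sign p * f y (x ∷ xs) - (sign p * f x (y ∷ xs) - sign p * alt xs (λ z zs → - f z (x ∷ y ∷ zs)))
      ≈⟨ +-congˡ (-‿cong (+-congˡ (-‿cong (*-congˡ
           (K.trans (alt-cong xs λ _ _ → K.sym (-1*x≈-x _)) (K.trans (alt-* xs (- 1#) _) (-1*x≈-x _))))))) ⟩
    sign p * f y (x ∷ xs) - (sign p * f x (y ∷ xs) - sign p * - alt xs (λ z zs → f z (x ∷ y ∷ zs)))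
      ≈⟨ solve 4 (λ s a b d → s :* b :- (s :* a :- s :* (:- d)) := (:- s) :* (a :- (b :- d))) K.refl _ _ _ _ ⟩
    - sign p * (f x (y ∷ xs) - (f y (x ∷ xs) - alt xs (λ z zs → f z (x ∷ y ∷ zs)))) ∎
  alt-↭ (↭.trans p p′) f eq = K.trans (alt-↭ p′ f eq) (K.trans (*-congˡ (alt-↭ p f eq)) (K.sym (*-assoc _ _ _)))

  minor-↭ : ∀ R {cs ds} (p : cs ↭ ds) → minor R ds ≈ sign p * minor R cs
  minor-↭ []      ↭.refl              = K.sym (*-identityˡ _)
  minor-↭ []      (prep _ _)        = K.sym (zeroʳ _)
  minor-↭ []      (swap _ _ _)      = K.sym (zeroʳ _)
  minor-↭ []      (↭.trans p p′)      =
    K.trans (minor-↭ [] p′) (K.trans (*-congˡ (minor-↭ [] p)) (K.sym (*-assoc _ _ _)))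
  minor-↭ (r ∷ R) p = alt-↭ p _ λ x p′ → K.trans (*-congˡ (minor-↭ R p′))
    (solve 3 (λ a b c → a :* (b :* c) := b :* (a :* c)) K.refl _ _ _)

  minor-↭-0 : ∀ R {cs ds} → cs ↭ ds → minor R cs ≈ 0# → minor R ds ≈ 0#
  minor-↭-0 R p eq = K.trans (minor-↭ R p) (scale-zero (sign p) eq)

  minor-adjacent-columns : ∀ R j cs → minor R (j ∷ j ∷ cs) ≈ 0#
  minor-adjacent-columns []      j cs = K.refl
  minor-adjacent-columns (r ∷ R) j cs = begin
    r j * minor R (j ∷ cs) - (r j * minor R (j ∷ cs) - alt cs (λ l ls → r l * minor R (j ∷ j ∷ ls)))
      ≈⟨ solve 2 (λ a b → a :- (a :- b) := b) K.refl _ _ ⟩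
    alt cs (λ l ls → r l * minor R (j ∷ j ∷ ls))
      ≈⟨ alt-0 cs (λ l ls → scale-zero (r l) (minor-adjacent-columns R j ls)) ⟩
    0# ∎

  minor-repeated-column : ∀ R {j cs} → j ∈ cs → minor R (j ∷ cs) ≈ 0#
  minor-repeated-column R {j} j∈cs with ys , zs , ≡.refl ← ∈-∃++ j∈cs =
    minor-↭-0 R (prep j (↭-sym (shift j ys zs))) (minor-adjacent-columns R j (ys ++ zs))

  alt-span : ∀ {W R} cs (f : ℕ → ℕ → List ℕ → Carrier) → (∀ l ls → Span W R (λ j → f j l ls)) →
             Span W R (λ j → alt cs (f j))
  alt-span []       f s = span-0 _ λ _ → K.refl
  alt-span (x ∷ xs) f s = span-- (s x xs) (alt-span xs (λ j y ys → f j y (x ∷ ys)) λ y ys → s y (x ∷ ys))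

  -- The expansion along the column j, with coefficients independent of j.
  minor-column-span : ∀ {W} R cs → Span W R (λ j → minor R (j ∷ cs))
  minor-column-span []      cs = [] λ _ → K.refl
  minor-column-span (r ∷ R) cs = sub (minor R cs) (span-resp
    (λ _ → solve 3 (λ a b d → (:- b) := (a :* d :- b) :- d :* a) K.refl _ _ _)
    (span-resp (λ _ → -1*x≈-x _) (span-* (- 1#)
      (alt-span cs (λ j l ls → r l * minor R (j ∷ ls)) λ l ls → span-* (r l) (minor-column-span R ls)))))

  -- The columns form a sublist of 0, ..., W - 1, so that `W` of them can only be all of them in
  -- order.
  NonzeroMinor : ℕ → List Seq → Set ℓ
  NonzeroMinor W R = ∃[ cs ] cs ⊆ tabulate {n = W} toℕ × length cs ≡ length R × ¬ minor R cs ≈ 0#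

  -- Restores the sublist after bordering by a column; the permutation costs only a sign.
  insert-column : ∀ {j : ℕ} {cs L} → cs ⊆ L → j ∈ L → j ∈ cs ⊎ ∃[ ds ] ds ⊆ L × ds ↭ j ∷ cs
  insert-column (y ∷ʳ s) (here ≡.refl) = inj₂ (_ , ≡.refl ∷ s , ↭.refl)
  insert-column (y ∷ʳ s) (there j∈L) with insert-column s j∈L
  ... | inj₁ j∈cs           = inj₁ j∈cs
  ... | inj₂ (ds , ds⊆ , p) = inj₂ (ds , y ∷ʳ ds⊆ , p)
  insert-column (≡.refl ∷ s) (here ≡.refl) = inj₁ (here ≡.refl)
  insert-column (≡.refl ∷ s) (there j∈L) with insert-column s j∈L
  ... | inj₁ j∈cs           = inj₁ (there j∈cs)
  ... | inj₂ (ds , ds⊆ , p) = inj₂ (_ , ≡.refl ∷ ds⊆ , ↭.trans (prep _ p) (swap _ _ ↭.refl))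

  -- If all minors bordering the nonzero minor d by the row r and a further
  -- column vanish, expanding them along r exhibits d * r as a combination of R.
  nonzero-minor-∷ : ∀ {W R r} → ¬ Span W R r → NonzeroMinor W R → NonzeroMinor W (r ∷ R)
  nonzero-minor-∷ {W} {R} {r} r∉ (cs , cs⊆ , len , d≉0)
    with ℕ.anyUpTo? (λ j → ¬? (minor (r ∷ R) (j ∷ cs) ≟ 0#)) W
  ... | yes (j , j<W , nz) with insert-column cs⊆ (≡.subst (_∈ _) (Fin.toℕ-fromℕ< j<W) (∈-tabulate⁺ (fromℕ< j<W)))
  ...   | inj₁ j∈cs           = contradiction (minor-repeated-column (r ∷ R) j∈cs) nz
  ...   | inj₂ (ds , ds⊆ , p) =
    ds , ds⊆ , ≡.trans (↭-length p) (≡.cong suc len) , λ z → nz (minor-↭-0 (r ∷ R) p z)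
  nonzero-minor-∷ {W} {R} {r} r∉ (cs , cs⊆ , len , d≉0) | no none =
    contradiction (span-resp dd⁻¹r≈r (span-* d⁻¹ dr∈)) r∉
    where
    d = minor R cs
    d⁻¹ = proj₁ (≉0⇒invertible d≉0)

    minor≈0 : ∀ {j} → j < W → minor (r ∷ R) (j ∷ cs) ≈ 0#
    minor≈0 {j} j<W = decidable-stable (minor (r ∷ R) (j ∷ cs) ≟ 0#) λ nz → none (j , j<W , nz)

    dr∈ : Span W R (λ j → d * r j)
    dr∈ = span-resp
      (λ j<W → K.sym (K.trans (solve 3 (λ a b e → e :* a := (a :* e :- b) :+ b) K.refl _ _ _)
                              (K.trans (+-congʳ (minor≈0 j<W)) (+-identityˡ _))))
      (alt-span cs (λ j l ls → r l * minor R (j ∷ ls)) λ l ls → span-* (r l) (minor-column-span R ls))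

    dd⁻¹r≈r : (λ j → d⁻¹ * (d * r j)) ≐[ W ] r
    dd⁻¹r≈r _ = K.trans (K.sym (*-assoc _ _ _))
      (K.trans (*-congʳ (proj₁ (proj₂ (≉0⇒invertible d≉0)))) (*-identityˡ _))

  data Independent (W : ℕ) : List Seq → Set (c ⊔ ℓ) where
    []  : Independent W []
    _∷_ : ∀ {r R} → ¬ Span W R r → Independent W R → Independent W (r ∷ R)

  independent⇒nonzero-minor : ∀ {W R} → Independent W R → NonzeroMinor W R
  independent⇒nonzero-minor []        = [] , minimum _ , ≡.refl , λ 1≈0 → 0#≉1# (K.sym 1≈0)
  independent⇒nonzero-minor (r∉ ∷ ri) = nonzero-minor-∷ r∉ (independent⇒nonzero-minor ri)

  independent⇒minor≉0 : ∀ {W R} → Independent W R → length R ≡ W → ¬ minor R (tabulate {n = W} toℕ) ≈ 0#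
  independent⇒minor≉0 {W} {R} ri len nz with cs , cs⊆ , len′ , d≉0 ← independent⇒nonzero-minor ri =
    d≉0 (K.trans (K.reflexive (≡.cong (minor R) (Pointwise-≡⇒≡
      (toPointwise (≡.trans len′ (≡.trans len (≡.sym (length-tabulate toℕ)))) cs⊆)))) nz)

  -- The determinant as a minor.

  open import Algebra.Properties.Semiring.Sum semiring using (sum-cong-≋) renaming (*-distribˡ-sum to *-distribˡ-∑)
  open RawSemiringDefs (Semiring.rawSemiring semiring) using (_^_) renaming (sum to ∑)

  signedSum : ∀ {n} → (Fin (suc n) → ℕ) → (ℕ → List ℕ → Carrier) → Carrier
  signedSum γ f = ∑ λ j → (- 1#) ^ toℕ j * f (γ j) (tabulate (γ ∘ punchIn j))

  -- Nested subtraction in `alt` plays the part of the powers of -1 in `det`; each level of the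
  -- recursion factors out one sign.
  alt-tabulate : ∀ {n} (γ : Fin (suc n) → ℕ) f → alt (tabulate γ) f ≈ signedSum γ f
  alt-tabulate {zero} γ f = +-cong (K.sym (*-identityˡ _)) (K.trans (-‿cong K.refl) (negate-zero K.refl))
  alt-tabulate {suc n} γ f = +-cong (K.sym (*-identityˡ _)) (begin
    - alt (tabulate (γ ∘ suc)) (λ y ys → f y (γ zero ∷ ys))
      ≈⟨ -1*x≈-x _ ⟨
    - 1# * alt (tabulate (γ ∘ suc)) (λ y ys → f y (γ zero ∷ ys))
      ≈⟨ *-congˡ (alt-tabulate (γ ∘ suc) (λ y ys → f y (γ zero ∷ ys))) ⟩
    - 1# * ∑ (λ j → (- 1#) ^ toℕ j * f (γ (suc j)) (γ zero ∷ tabulate (γ ∘ suc ∘ punchIn j)))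
      ≈⟨ *-distribˡ-∑ (- 1#) (λ j → (- 1#) ^ toℕ j * f (γ (suc j)) (γ zero ∷ tabulate (γ ∘ suc ∘ punchIn j))) ⟩
    ∑ (λ j → - 1# * ((- 1#) ^ toℕ j * f (γ (suc j)) (γ zero ∷ tabulate (γ ∘ suc ∘ punchIn j))))
      ≈⟨ sum-cong-≋ {suc n} (λ j → K.sym (*-assoc (- 1#) ((- 1#) ^ toℕ j)
                                                  (f (γ (suc j)) (γ zero ∷ tabulate (γ ∘ suc ∘ punchIn j))))) ⟩
    ∑ (λ j → (- 1#) ^ suc (toℕ j) * f (γ (suc j)) (γ zero ∷ tabulate (γ ∘ suc ∘ punchIn j))) ∎)

  det-cong : ∀ {n} {M M′ : Matrix Carrier n} → (∀ i j → M i j ≈ M′ i j) →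
             det commutativeRing M ≈ det commutativeRing M′
  det-cong {zero}  eq = K.refl
  det-cong {suc n} eq = sum-cong-≋ λ j →
    *-congˡ {(- 1#) ^ toℕ j} (*-cong (eq zero j) (det-cong λ r s → eq (suc r) (punchIn j s)))

  -- The column map is arbitrary because each Laplace expansion composes it with some `punchIn j`.
  det≈minor : ∀ {n} (ρ : Fin n → Seq) (γ : Fin n → ℕ) →
              det commutativeRing (λ i j → ρ i (γ j)) ≈ minor (tabulate ρ) (tabulate γ)
  det≈minor {zero}  ρ γ = K.refl
  det≈minor {suc n} ρ γ = K.trans
    (sum-cong-≋ {suc n} λ j → *-congˡ {(- 1#) ^ toℕ j} (*-congˡ {ρ zero (γ j)} (det≈minor (ρ ∘ suc) (γ ∘ punchIn j))))
    (K.sym (alt-tabulate γ (λ j js → ρ zero j * minor (tabulate (ρ ∘ suc)) js)))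

-- Indicators and finite sums.

private variable
  levelA levelB : Level
  A : Set levelA
  B : Set levelB

indicator : Dec A → ℕ
indicator (yes _) = 1
indicator (no  _) = 0

indicator-yes : (d : Dec A) → A → indicator d ≡ 1
indicator-yes (yes _) _ = ≡.refl
indicator-yes (no ¬a) a = contradiction a ¬a

indicator-no : (d : Dec A) → ¬ A → indicator d ≡ 0
indicator-no (yes a) ¬a = contradiction a ¬a
indicator-no (no _)  _  = ≡.refl

indicator-cong : (d : Dec A) (e : Dec B) → (A → B) → (B → A) → indicator d ≡ indicator e
indicator-cong (yes a) e f g = ≡.sym (indicator-yes e (f a))
indicator-cong (no ¬a) e f g = ≡.sym (indicator-no e (¬a ∘ g))

indicator-¬ : (d : Dec A) → indicator d ℕ.+ indicator (¬? d) ≡ 1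
indicator-¬ (yes _) = ≡.refl
indicator-¬ (no  _) = ≡.refl

indicator-0⇒¬ : (d : Dec A) → indicator d ≡ 0 → ¬ A
indicator-0⇒¬ (no ¬a) _ = ¬a

sum-0 : ∀ {n} {g : Fin n → ℕ} → (∀ i → g i ≡ 0) → sum g ≡ 0
sum-0 {n} eq = ≡.trans (sum-cong-≗ eq) (sum-replicate-zero n)

sum-const : ∀ n c → sum {n} (λ _ → c) ≡ n ℕ.* c
sum-const zero    c = ≡.refl
sum-const (suc n) c = ≡.cong (c ℕ.+_) (sum-const n c)

sum≡0⇒0 : ∀ {n} (g : Fin n → ℕ) → sum g ≡ 0 → ∀ i → g i ≡ 0
sum≡0⇒0 g eq zero    = ℕ.m+n≡0⇒m≡0 (g zero) eq
sum≡0⇒0 g eq (suc i) = sum≡0⇒0 (g ∘ suc) (ℕ.m+n≡0⇒n≡0 (g zero) eq) i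

sum-unique : ∀ {p n} {P : Fin n → Set p} (P? : ∀ i → Dec (P i)) → (∀ {i j} → P i → P j → i ≡ j) →
             (d : Dec (∃ P)) → sum (indicator ∘ P?) ≡ indicator d
sum-unique {n = zero}  P? u d = ≡.sym (indicator-no d λ ())
sum-unique {n = suc n} P? u d with P? zero
... | yes p = ≡.trans (≡.cong suc (sum-0 λ i → indicator-no (P? (suc i)) λ p′ → Fin.0≢1+n (u p p′)))
                      (≡.sym (indicator-yes d (zero , p)))
... | no ¬p = ≡.trans (sum-unique (P? ∘ suc) (λ p p′ → Fin.suc-injective (u p p′)) (Fin.any? (P? ∘ suc)))
                      (indicator-cong (Fin.any? (P? ∘ suc)) d (λ (i , p) → suc i , p)
                        λ { (zero , p) → contradiction p ¬p ; (suc i , p) → i , p })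

-- Counting vectors over the field.

module Counting {c ℓ q} (F : FiniteField c ℓ q) where
  open FiniteField F hiding (zero; refl; trans; sym)
  private module K = FiniteField F
  open DifferenceSolver commutativeRing
  open LinearAlgebra F
  open Inverse index using (to; from; to-cong; strictlyInverseˡ)

  sumF : (Carrier → ℕ) → ℕ
  sumF g = sum (g ∘ from)

  sumF-cong : ∀ {g h : Carrier → ℕ} → (∀ x → g x ≡ h x) → sumF g ≡ sumF h
  sumF-cong eq = sum-cong-≗ {q} (eq ∘ from)

  sumF-translate : ∀ {g : Carrier → ℕ} → (∀ {x y} → x ≈ y → g x ≡ g y) → ∀ y → sumF (λ x → g (x + y)) ≡ sumF g
  sumF-translate {g} resp y = ≡.trans
    (sumF-cong {λ x → g (x + y)} {λ x → g (from (to (x + y)))} λ x → resp (K.sym (from-to (x + y))))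
    (≡.sym (sum-permute (g ∘ from) (Perm.permutation (λ i → to (from i + y)) (λ i → to (from i - y))
      (λ i → inv (solve 2 (λ a b → (a :- b) :+ b := a) K.refl _ _))
      (λ i → inv (solve 2 (λ a b → (a :+ b) :- b := a) K.refl _ _)))))
    where
    inv : ∀ {i w z} → w + z ≈ from i → to (from (to w) + z) ≡ i
    inv {i} eq = ≡.trans (to-cong (K.trans (+-congʳ (from-to _)) eq)) (strictlyInverseˡ i)

  infixr 5 _◂_
  _◂_ : Carrier → Seq → Seq
  (x ◂ z) zero    = x
  (x ◂ z) (suc j) = z j

  0ˢ : Seq
  0ˢ _ = 0#

  -- A sum over F^n whose tuples are padded with 0 to sequences, so that one `g` can be summed at
  -- several lengths.
  sumF^ : ℕ → (Seq → ℕ) → ℕ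
  sumF^ zero    g = g 0ˢ
  sumF^ (suc n) g = sumF λ x → sumF^ n λ z → g (x ◂ z)

  -- Functions are not extensional here, so it has to be recorded that `g` does not separate
  -- pointwise equivalent sequences.
  Respects : ℕ → (Seq → ℕ) → Set _
  Respects W g = ∀ {u v} → u ≐[ W ] v → g u ≡ g v

  ◂-cong : ∀ {n x y u v} → x ≈ y → u ≐[ n ] v → x ◂ u ≐[ suc n ] y ◂ v
  ◂-cong x≈y u≐v {zero}  _         = x≈y
  ◂-cong x≈y u≐v {suc j} (s≤s j<n) = u≐v j<n

  sumF^-cong : ∀ n {g h : Seq → ℕ} → (∀ z → g z ≡ h z) → sumF^ n g ≡ sumF^ n h
  sumF^-cong zero    eq = eq 0ˢ
  sumF^-cong (suc n) eq = sumF-cong λ x → sumF^-cong n λ z → eq (x ◂ z)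

  sumF^-const : ∀ n k → sumF^ n (λ _ → k) ≡ q ℕ.^ n ℕ.* k
  sumF^-const zero    k = ≡.sym (ℕ.+-identityʳ k)
  sumF^-const (suc n) k = ≡.trans (sumF-cong λ _ → sumF^-const n k)
    (≡.trans (sum-const q _) (≡.sym (ℕ.*-assoc q (q ℕ.^ n) k)))

  sumF^-+ : ∀ n g h → sumF^ n (λ z → g z ℕ.+ h z) ≡ sumF^ n g ℕ.+ sumF^ n h
  sumF^-+ zero    g h = ≡.refl
  sumF^-+ (suc n) g h = ≡.trans (sumF-cong λ x → sumF^-+ n (λ z → g (x ◂ z)) (λ z → h (x ◂ z)))
    (∑-distrib-+ {q} _ _)

  sumF^-* : ∀ n k g → sumF^ n (λ z → k ℕ.* g z) ≡ k ℕ.* sumF^ n g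
  sumF^-* zero    k g = ≡.refl
  sumF^-* (suc n) k g = ≡.trans (sumF-cong λ x → sumF^-* n k (λ z → g (x ◂ z)))
    (≡.sym (*-distribˡ-sum {q} k _))

  sumF^-sumF : ∀ n (g : Carrier → Seq → ℕ) → sumF^ n (λ z → sumF λ t → g t z) ≡ sumF λ t → sumF^ n (g t)
  sumF^-sumF zero    g = ≡.refl
  sumF^-sumF (suc n) g = ≡.trans (sumF-cong λ x → sumF^-sumF n (λ t z → g t (x ◂ z)))
    (∑-comm {q} {q} λ i j → sumF^ n λ z → g (from j) (from i ◂ z))

  sumF^-translate : ∀ n {g} → Respects n g → ∀ (y : Seq) → sumF^ n (λ z → g (λ j → z j + y j)) ≡ sumF^ n g
  sumF^-translate zero    resp y = resp λ ()
  sumF^-translate (suc n) {g} resp y = begin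
    sumF (λ x → sumF^ n λ z → g (λ j → (x ◂ z) j + y j))
      ≡⟨ sumF-cong (λ x → sumF^-cong n λ z → resp
           (≐-cases (λ j → (x ◂ z) j + y j) ((x + y 0) ◂ λ j → z j + y (suc j)) K.refl λ _ → K.refl)) ⟩
    sumF (λ x → sumF^ n λ z → g ((x + y 0) ◂ λ j → z j + y (suc j)))
      ≡⟨ sumF-cong (λ x → sumF^-translate n {λ z → g ((x + y 0) ◂ z)} (λ u≐v → resp (◂-cong K.refl u≐v)) (y ∘ suc)) ⟩
    sumF (λ x → sumF^ n λ z → g ((x + y 0) ◂ z))
      ≡⟨ sumF-translate {λ x → sumF^ n λ z → g (x ◂ z)} (λ x≈y → sumF^-cong n λ z → resp (◂-cong x≈y λ _ → K.refl)) (y 0) ⟩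
    sumF (λ x → sumF^ n λ z → g (x ◂ z)) ∎
    where open ≡-Reasoning

  splice : ℕ → Seq → Seq → Seq
  splice zero    u v j       = v j
  splice (suc l) u v zero    = u zero
  splice (suc l) u v (suc j) = splice l (u ∘ suc) v j

  splice-< : ∀ {l j} u v → j < l → splice l u v j ≡ u j
  splice-< {suc l} {zero}  u v _         = ≡.refl
  splice-< {suc l} {suc j} u v (s≤s j<l) = splice-< (u ∘ suc) v j<l

  splice-+ : ∀ l u v j → splice l u v (l ℕ.+ j) ≡ v j
  splice-+ zero    u v j = ≡.refl
  splice-+ (suc l) u v j = splice-+ l (u ∘ suc) v j

  splice-unique : ∀ l {n u v w} → w ≐[ l ] u → (λ j → w (l ℕ.+ j)) ≐[ n ] v → w ≐[ l ℕ.+ n ] splice l u v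
  splice-unique zero    w≐u w≐v j<n               = w≐v j<n
  splice-unique (suc l) w≐u w≐v {zero}  _         = w≐u (s≤s z≤n)
  splice-unique (suc l) w≐u w≐v {suc j} (s≤s j<W) = splice-unique l (λ i<l → w≐u (s≤s i<l)) w≐v j<W

  splice-cong : ∀ l {n u u′ v v′} → u ≐[ l ] u′ → v ≐[ n ] v′ → splice l u v ≐[ l ℕ.+ n ] splice l u′ v′
  splice-cong l u≐ v≐ = splice-unique l
    (λ j<l → K.trans (K.reflexive (splice-< _ _ j<l)) (u≐ j<l))
    (λ j<n → K.trans (K.reflexive (splice-+ l _ _ _)) (v≐ j<n))

  sumF^-split : ∀ a {b W g} → Respects W g → sumF^ (a ℕ.+ b) g ≡ sumF^ a λ x → sumF^ b λ y → g (splice a x y)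
  sumF^-split zero    resp = ≡.refl
  sumF^-split (suc a) {b} {W} {g} resp = sumF-cong λ x →
    ≡.trans (sumF^-split a {g = λ z → g (x ◂ z)} (λ u≐v → resp (λ {j} j<W → ◂-cong {W} K.refl u≐v (ℕ.m<n⇒m<1+n j<W))))
            (sumF^-cong a λ u → sumF^-cong b λ v → resp
              (≐-cases (x ◂ splice a u v) (splice (suc a) (x ◂ u) v) K.refl λ _ → K.refl))

  sumF^-0 : ∀ n {g} → Respects n g → sumF^ n g ≡ 0 → ∀ z → g z ≡ 0
  sumF^-0 zero    resp eq z = ≡.trans (resp λ ()) eq
  sumF^-0 (suc n) {g} resp eq z = ≡.trans
    (resp (≐-cases z (from (to (z 0)) ◂ z ∘ suc) (K.sym (from-to (z 0))) λ _ → K.refl))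
    (sumF^-0 n (λ u≐v → resp (◂-cong K.refl u≐v))
      (sum≡0⇒0 (λ i → sumF^ n λ z → g (from i ◂ z)) eq (to (z 0))) (z ∘ suc))

  module _ {p} {P : Seq → Set p} (P? : ∀ z → Dec (P z)) where
    sumF^-¬ : ∀ n → sumF^ n (λ z → indicator (P? z)) ℕ.+ sumF^ n (λ z → indicator (¬? (P? z))) ≡ q ℕ.^ n
    sumF^-¬ n = ≡.trans (≡.sym (sumF^-+ n _ _)) (≡.trans (sumF^-cong n λ z → indicator-¬ (P? z))
      (≡.trans (sumF^-const n 1) (ℕ.*-identityʳ _)))

    -- The way back from cardinalities to containments: the complement has count 0, so it is empty.
    sumF^-full⇒∀ : ∀ n → (∀ {u v} → u ≐[ n ] v → P u → P v) →
                   sumF^ n (λ z → indicator (P? z)) ≡ q ℕ.^ n → ∀ z → P z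
    sumF^-full⇒∀ n resp eq z = decidable-stable (P? z) (indicator-0⇒¬ (¬? (P? z)) (sumF^-0 n
      (λ {u} {v} u≐v → indicator-cong (¬? (P? u)) (¬? (P? v))
        (_∘ resp (λ j<n → K.sym (u≐v j<n))) (_∘ resp u≐v))
      (ℕ.+-cancelˡ-≡ (q ℕ.^ n) _ _ (≡.trans
        (≡.cong (ℕ._+ sumF^ n (λ z → indicator (¬? (P? z)))) (≡.sym eq))
        (≡.trans (sumF^-¬ n) (≡.sym (ℕ.+-identityʳ _))))) z))

    sumF^-all : ∀ n → (∀ z → P z) → sumF^ n (λ z → indicator (P? z)) ≡ q ℕ.^ n
    sumF^-all n all = ≡.trans (sumF^-cong n λ z → indicator-yes (P? z) (all z))
      (≡.trans (sumF^-const n 1) (ℕ.*-identityʳ _))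

  sumF^-≐0 : ∀ n (P? : ∀ (z : Seq) → Dec (z ≐[ n ] 0ˢ)) → sumF^ n (λ z → indicator (P? z)) ≡ 1
  sumF^-≐0 zero    P? = indicator-yes (P? 0ˢ) λ ()
  sumF^-≐0 (suc n) P? = ≡.trans (sum-cong-≗ inner)
    (≡.trans (sum-unique (λ i → from i ≟ 0#)
       (λ e e′ → ≡.trans (≡.sym (strictlyInverseˡ _)) (≡.trans (to-cong (K.trans e (K.sym e′))) (strictlyInverseˡ _)))
       (Fin.any? λ i → from i ≟ 0#))
     (indicator-yes _ (to 0# , from-to 0#)))
    where
    all0? : ∀ (z : Seq) → Dec (z ≐[ n ] 0ˢ)
    all0? z = ℕ.allUpTo? (λ j → z j ≟ 0#) n

    inner : ∀ i → sumF^ n (λ z → indicator (P? (from i ◂ z))) ≡ indicator (from i ≟ 0#)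
    inner i with from i ≟ 0#
    ... | yes e = ≡.trans (sumF^-cong n λ z → indicator-cong (P? (from i ◂ z)) (all0? z)
                             (λ h j<n → h (s≤s j<n))
                             (λ h → λ { {zero} _ → e ; {suc j} (s≤s j<n) → h j<n }))
                          (sumF^-≐0 n all0?)
    ... | no ¬e = ≡.trans (sumF^-cong n λ z → indicator-no (P? (from i ◂ z)) λ h → ¬e (h (s≤s z≤n)))
                          (≡.trans (sumF^-const n 0) (ℕ.*-zeroʳ (q ℕ.^ n)))

  -- As `b` lies outside the span of `R`, a vector of the larger span determines its coefficient at
  -- `b`. The sum over coefficients thus has at most one nonzero term.
  span-indicator-∷ : ∀ {W R b} → ¬ Span W R b → ∀ v →
    indicator (span? W (b ∷ R) v) ≡ sumF λ t → indicator (span? W R (λ j → v j - t * b j))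
  span-indicator-∷ {W} {R} {b} b∉ v = ≡.sym (≡.trans
    (sum-unique (λ i → span? W R (λ j → v j - from i * b j)) unique (Fin.any? λ i → span? W R (λ j → v j - from i * b j)))
    (indicator-cong _ (span? W (b ∷ R) v) (λ (i , s) → sub (from i) s)
      λ { (sub t s) → to t , span-resp (λ _ → +-congˡ (-‿cong (*-congʳ (K.sym (from-to t))))) s }))
    where
    coefficient-unique : ∀ {s t} → Span W R (λ j → v j - s * b j) → Span W R (λ j → v j - t * b j) → s ≈ t
    coefficient-unique {s} {t} ss st = decidable-stable (s ≟ t) λ s≉t →
      let d⁻¹ , d⁻¹d , _ = ≉0⇒invertible {t - s} λ e → s≉t (K.trans (K.sym (+-identityʳ s)) (K.trans (+-congˡ (K.sym e))
                             (solve 2 (λ s t → s :+ (t :- s) := t) K.refl s t)))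
      in b∉ (span-resp
           (λ _ → K.trans (solve 5 (λ i s t v b → i :* ((v :- s :* b) :- (v :- t :* b)) := (i :* (t :- s)) :* b) K.refl d⁻¹ s t _ _)
                          (K.trans (*-congʳ d⁻¹d) (*-identityˡ _)))
           (span-* d⁻¹ (span-- ss st)))

    unique : ∀ {i j} → Span W R (λ k → v k - from i * b k) → Span W R (λ k → v k - from j * b k) → i ≡ j
    unique si sj = ≡.trans (≡.sym (strictlyInverseˡ _)) (≡.trans (to-cong (coefficient-unique si sj)) (strictlyInverseˡ _))

  -- The cardinality of V ∩ E, for V the span of R.
  tailCount : ℕ → ℕ → List Seq → ℕ
  tailCount l n R = sumF^ n λ u → indicator (span? (l ℕ.+ n) R (splice l 0ˢ u))

  -- Modulo the span of `R`, `b` equals the vector of E with tail `y`. A coefficient `t` at `b`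
  -- therefore only translates the tail by `t * y`, and each of the `q` coefficients contributes
  -- `tailCount l n R`.
  tailCount-∷ : ∀ l n {R b} y → Span (l ℕ.+ n) R (λ j → splice l 0ˢ y j - b j) → ¬ Span (l ℕ.+ n) R b →
                tailCount l n (b ∷ R) ≡ q ℕ.* tailCount l n R
  tailCount-∷ l n {R} {b} y y-b∈ b∉ = begin
    tailCount l n (b ∷ R)
      ≡⟨ sumF^-cong n (λ u → span-indicator-∷ b∉ (splice l 0ˢ u)) ⟩
    sumF^ n (λ u → sumF λ t → indicator (span? W R (λ j → splice l 0ˢ u j - t * b j)))
      ≡⟨ sumF^-sumF n (λ t u → indicator (span? W R (λ j → splice l 0ˢ u j - t * b j))) ⟩
    sumF (λ t → sumF^ n λ u → indicator (span? W R (λ j → splice l 0ˢ u j - t * b j)))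
      ≡⟨ sumF-cong (λ t → sumF^-cong n λ u → shift-inside t u) ⟩
    sumF (λ t → sumF^ n λ u → indicator (span? W R (splice l 0ˢ λ j → u j + - (t * y j))))
      ≡⟨ sumF-cong (λ t → sumF^-translate n {λ u → indicator (span? W R (splice l 0ˢ u))}
           (λ {u} {v} u≐v → indicator-cong (span? W R _) (span? W R _)
             (span-resp (splice-cong l (λ _ → K.refl) u≐v))
             (span-resp (splice-cong l (λ _ → K.refl) λ j<n → K.sym (u≐v j<n))))
           (λ j → - (t * y j))) ⟩
    sumF (λ _ → tailCount l n R)
      ≡⟨ sum-const q _ ⟩
    q ℕ.* tailCount l n R ∎
    where
    open ≡-Reasoning
    W = l ℕ.+ n

    splice-linear : ∀ t u → (λ j → splice l 0ˢ u j - t * splice l 0ˢ y j) ≐[ W ] splice l 0ˢ (λ j → u j + - (t * y j))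
    splice-linear t u = splice-unique l
      (λ j<l → K.trans (+-cong (K.reflexive (splice-< _ _ j<l)) (-‿cong (*-congˡ (K.reflexive (splice-< _ _ j<l)))))
                       (K.trans (+-congˡ (negate-zero (zeroʳ t))) (+-identityʳ 0#)))
      (λ j<n → +-cong (K.reflexive (splice-+ l _ _ _)) (-‿cong (*-congˡ (K.reflexive (splice-+ l _ _ _)))))

    shift-inside : ∀ t u → indicator (span? W R (λ j → splice l 0ˢ u j - t * b j)) ≡
                           indicator (span? W R (splice l 0ˢ λ j → u j + - (t * y j)))
    shift-inside t u = indicator-cong (span? W R _) (span? W R _)
      (λ s → span-resp (λ j<W → K.trans
        (solve 4 (λ u t b y → (u :- t :* b) :+ (:- t) :* (y :- b) := u :- t :* y) K.refl _ t _ _)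
        (splice-linear t u j<W)) (span-+* (- t) s y-b∈))
      (λ s → span-resp (λ j<W → K.trans (+-congʳ (K.sym (splice-linear t u j<W)))
        (solve 4 (λ u t b y → (u :- t :* y) :+ t :* (y :- b) := u :- t :* b) K.refl _ t _ _)) (span-+* t s y-b∈))

  -- For `l = 0` the tail is the whole vector, so this is the cardinality of the span, which stands
  -- in for its dimension.
  tailCount-independent : ∀ {W R} → Independent W R → tailCount 0 W R ≡ q ℕ.^ List.length R
  tailCount-independent {W} []                 = ≡.trans
    (sumF^-cong W λ z → indicator-cong (span? W [] _) (all0? z) (λ { ([] h) → h }) λ h → [] h)
    (sumF^-≐0 W all0?)
    where
    all0? : ∀ (z : Seq) → Dec (z ≐[ W ] 0ˢ)
    all0? z = ℕ.allUpTo? (λ j → z j ≟ 0#) W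
  tailCount-independent {W} (_∷_ {r} {R} r∉ ri) = ≡.trans
    (tailCount-∷ 0 W r (span-0 R λ _ → -‿inverseʳ _) r∉)
    (≡.cong (q ℕ.*_) (tailCount-independent ri))

-- The product of q^m - q^D over m - e ≤ D < m; used only for e ≤ m.
admissible : ℕ → ℕ → ℕ → ℕ
admissible q m zero    = 1
admissible q m (suc e) = (q ℕ.^ m ℕ.∸ q ℕ.^ (m ℕ.∸ suc e)) ℕ.* admissible q m e

module FieldOrder {c ℓ q} (F : FiniteField c ℓ q) where
  open FiniteField F hiding (zero; refl; trans; sym)
  private module K = FiniteField F
  open Inverse index using (to)
  open LinearAlgebra F using (from-to)

  1<order : 1 < q
  1<order = distinct (to 0#) (to 1#) λ e → 0#≉1# (K.trans (K.sym (from-to 0#))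
    (K.trans (K.reflexive (≡.cong (Inverse.from index) e)) (from-to 1#)))
    where
    distinct : ∀ {n} (i j : Fin n) → ¬ i ≡ j → 1 < n
    distinct {suc zero}    zero zero i≢j = contradiction ≡.refl i≢j
    distinct {suc (suc _)} _    _    _   = s≤s (s≤s z≤n)

  q^-injective : ∀ {a b} → q ℕ.^ a ≡ q ℕ.^ b → a ≡ b
  q^-injective {a} {b} eq with ℕ.<-cmp a b
  ... | tri< a<b _ _ = contradiction eq (ℕ.<⇒≢ (ℕ.^-monoʳ-< q 1<order a<b))
  ... | tri≈ _ a≡b _ = a≡b
  ... | tri> _ _ b<a = contradiction (≡.sym eq) (ℕ.<⇒≢ (ℕ.^-monoʳ-< q 1<order b<a))

-- Growing the matrix row by row.

module Growth {c ℓ q} (F : FiniteField c ℓ q) (l n : ℕ) where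
  open FiniteField F hiding (zero; refl; trans; sym)
  private module K = FiniteField F
  open DifferenceSolver commutativeRing
  open LinearAlgebra F
  open Counting F
  open FieldOrder F

  m W : ℕ
  m = suc n
  W = l ℕ.+ m

  columns : List ℕ
  columns = tabulate {n = W} toℕ

  columns<W : All (_< W) columns
  columns<W = All.tabulate⁺ Fin.toℕ<n

  shifted : Seq → Seq
  shifted r j = r (m ℕ.+ j)

  next : Seq → Seq → Seq
  next r z = splice l (shifted r) z

  -- The newest row is kept apart because the next one is built from it. Newest first is also the
  -- order of the matrix from top to bottom.
  grow : ℕ → Seq → List Seq → Seq → List Seq
  grow zero    r R z = r ∷ R
  grow (suc j) r R z = grow j (next r z) (r ∷ R) (shifted z)

  m+<W : ∀ {j} → j < l → m ℕ.+ j < W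
  m+<W {j} j<l = ≡.subst (m ℕ.+ j <_) (ℕ.+-comm m l) (ℕ.+-monoʳ-< m j<l)

  grow-cong : ∀ j {r r′ R R′ z z′} → r ≐[ W ] r′ → Pointwise _≐[ W ]_ R R′ → z ≐[ j ℕ.* m ] z′ →
              Pointwise _≐[ W ]_ (grow j r R z) (grow j r′ R′ z′)
  grow-cong zero    r≐ R≐ z≐ = r≐ ∷ R≐
  grow-cong (suc j) r≐ R≐ z≐ = grow-cong j
    (splice-cong l (λ i<l → r≐ (m+<W i<l)) (λ i<m → z≐ (ℕ.<-≤-trans i<m (ℕ.m≤m+n m (j ℕ.* m)))))
    (r≐ ∷ R≐) (λ i<jm → z≐ (ℕ.+-monoʳ-< m i<jm))

  nonsingular? : ∀ R → Dec (¬ minor R columns ≈ 0#)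
  nonsingular? R = ¬? (minor R columns ≟ 0#)

  nonsingular : List Seq → ℕ
  nonsingular R = indicator (nonsingular? R)

  nonsingular-cong : ∀ {R R′} → Pointwise _≐[ W ]_ R R′ → nonsingular R ≡ nonsingular R′
  nonsingular-cong {R} {R′} R≐ = indicator-cong (nonsingular? R) (nonsingular? R′)
    (λ nz z → nz (K.trans (minor-cong R≐ columns<W) z))
    (λ nz z → nz (K.trans (K.sym (minor-cong R≐ columns<W)) z))

  ≐-refl : ∀ {R} → Pointwise _≐[ W ]_ R R
  ≐-refl {[]}    = []
  ≐-refl {_ ∷ _} = (λ _ → K.refl) ∷ ≐-refl

  nonsingular-respects : ∀ j r R → Respects (j ℕ.* m) (λ z → nonsingular (grow j r R z))
  nonsingular-respects j r R z≐ = nonsingular-cong (grow-cong j (λ _ → K.refl) ≐-refl z≐)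

  completions : ℕ → Seq → List Seq → ℕ
  completions j r R = sumF^ (j ℕ.* m) λ z → nonsingular (grow j r R z)

  splice-prefix : ∀ a x y → splice a x y ≐[ a ] x
  splice-prefix a x y i<a = K.reflexive (splice-< x y i<a)

  completions-suc : ∀ j r R → completions (suc j) r R ≡ sumF^ m λ x → completions j (next r x) (r ∷ R)
  completions-suc j r R = ≡.trans (sumF^-split m (nonsingular-respects (suc j) r R))
    (sumF^-cong m λ x → sumF^-cong (j ℕ.* m) λ y → nonsingular-cong
      (grow-cong j {R = r ∷ R} {z = shifted (splice m x y)} {z′ = y}
        (splice-cong l {u = shifted r} (λ _ → K.refl) (splice-prefix m x y)) ≐-refl
        (λ _ → K.reflexive (splice-+ m x y _))))

  -- All column lists are treated at once, because expanding along a new top row leads to shorter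
  -- ones.
  grow-dependent : ∀ j {r R} z → (∀ {cs} → All (_< W) cs → minor (r ∷ R) cs ≈ 0#) →
                   ∀ {cs} → All (_< W) cs → minor (grow j r R z) cs ≈ 0#
  grow-dependent zero    z m≈0 = m≈0
  grow-dependent (suc j) {r} {R} z m≈0 = grow-dependent j (shifted z) λ {cs} cs<W → K.trans
    (alt-cong-All {g = λ _ _ → 0#} cs<W λ {x} {xs} _ xs<W → scale-zero (next r z x) (m≈0 xs<W))
    (alt-0 cs λ _ _ → K.refl)

  completions-dependent : ∀ j {r R} → Span W R r → completions j r R ≡ 0
  completions-dependent j {r} {R} s = ≡.trans
    (sumF^-cong (j ℕ.* m) λ z → indicator-no (nonsingular? (grow j r R z)) λ nz →
      nz (grow-dependent j z (λ cs<W → minor-dependent cs<W s) columns<W))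
    (≡.trans (sumF^-const (j ℕ.* m) 0) (ℕ.*-zeroʳ (q ℕ.^ (j ℕ.* m))))

  -- `shift-span` persists because each row of `R` has its successor in `r ∷ R`. So only the shift
  -- of the newest row can leave the prefixes of the span, and this is the case distinction of the
  -- count.
  record State (D : ℕ) (r : Seq) (R : List Seq) : Set (c ⊔ ℓ) where
    field
      independent : Independent W (r ∷ R)
      shift-span  : ∀ {s} → Span W R s → Span l (r ∷ R) (shifted s)
      tail-count  : tailCount l m (r ∷ R) ≡ q ℕ.^ D
  open State

  l≤W : l ≤ W
  l≤W = ℕ.m≤m+n l m

  next-prefix : ∀ r x → next r x ≐[ l ] shifted r
  next-prefix r x = splice-prefix l (shifted r) x

  next-shift-span : ∀ {D r R} x → State D r R → ∀ {s} → Span W (r ∷ R) s → Span l (next r x ∷ r ∷ R) (shifted s)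
  next-shift-span {r = r} {R} x st (sub t s) = span-resp
    (λ j<l → K.trans (+-congˡ (*-congˡ (next-prefix r x j<l)))
                     (solve 3 (λ s t r → (s :- t :* r) :+ t :* r := s) K.refl _ t _))
    (span-+* t (span-weaken (next r x) (shift-span st s)) (span-head (next r x) (r ∷ R)))

  -- A vector of E in the enlarged span has coefficient 0 at the new row: dividing by a nonzero one
  -- would put the prefix `shifted r` into the old span. Hence V ∩ E is unchanged for every `x`.
  fresh-state : ∀ {D r R} → State D r R → ¬ Span l (r ∷ R) (shifted r) → ∀ x → State D (next r x) (r ∷ R)
  fresh-state {D} {r} {R} st c∉ x = record
    { independent = (λ s → c∉ (span-resp (next-prefix r x) (span-narrow l≤W s))) ∷ independent st
    ; shift-span  = next-shift-span x st
    ; tail-count  = ≡.trans (sumF^-cong m λ u → indicator-cong (span? W _ _) (span? W _ _) (drop u) (span-weaken (next r x)))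
                            (tail-count st)
    }
    where
    drop : ∀ u → Span W (next r x ∷ r ∷ R) (splice l 0ˢ u) → Span W (r ∷ R) (splice l 0ˢ u)
    drop u (sub t s) with t ≟ 0#
    ... | yes t≈0 = span-resp (λ _ → K.trans (+-congˡ (negate-zero (K.trans (*-congʳ t≈0) (zeroˡ _)))) (+-identityʳ _)) s
    ... | no  t≉0 with t⁻¹ , t⁻¹t , _ ← ≉0⇒invertible t≉0 = contradiction
      (span-resp (λ {j} j<l → K.trans
          (*-congˡ (+-cong (splice-prefix l 0ˢ u j<l) (-‿cong (*-congˡ (next-prefix r x j<l)))))
          (K.trans (solve 4 (λ i t r z → (:- i) :* (z :- t :* r) := (i :* t) :* r :- i :* z) K.refl t⁻¹ t _ 0#)
            (K.trans (+-cong (K.trans (*-congʳ t⁻¹t) (*-identityˡ _)) (negate-zero (zeroʳ t⁻¹))) (+-identityʳ _))))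
        (span-* (- t⁻¹) (span-narrow l≤W s)))
      c∉

  module _ {D r R} (st : State D r R) (c∈ : Span l (r ∷ R) (shifted r)) where
    private
      S = r ∷ R
      -- `v` is a vector of the span with the prefix of the coming row. The row minus `v` lies in E
      -- and has the tail `offset x`.
      lift = span-extend c∈
      v = proj₁ lift
      v∈ = proj₂ (proj₂ lift) W
      offset : Seq → Seq
      offset x j = x j + - v (l ℕ.+ j)

    next-lift : ∀ x → splice l 0ˢ (offset x) ≐[ W ] (λ j → next r x j - v j)
    next-lift x j<W = K.sym (splice-unique l
      (λ j<l → K.trans (+-cong (next-prefix r x j<l) (-‿cong (proj₁ (proj₂ lift) j<l))) (-‿inverseʳ _))
      (λ j<m → +-congʳ (K.reflexive (splice-+ l _ _ _))) j<W)

    -- Subtracting `v` does not affect membership in the span, and `offset` permutes F^m; so this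
    -- counts V ∩ E.
    next-dependent-count : sumF^ m (λ x → indicator (span? W S (next r x))) ≡ q ℕ.^ D
    next-dependent-count = ≡.trans
      (sumF^-cong m λ x → indicator-cong (span? W S (next r x)) (span? W S (splice l 0ˢ (offset x)))
        (λ s → span-resp (λ j<W → K.sym (next-lift x j<W)) (span-- s v∈))
        (λ s → span-resp (λ j<W → K.trans (+-cong (next-lift x j<W) (*-identityˡ _))
                                          (solve 2 (λ a b → (a :- b) :+ b := a) K.refl _ _)) (span-+* 1# s v∈)))
      (≡.trans (sumF^-translate m {λ u → indicator (span? W S (splice l 0ˢ u))}
                 (λ u≐v → indicator-cong (span? W S _) (span? W S _)
                   (span-resp (splice-cong l (λ _ → K.refl) u≐v))
                   (span-resp (splice-cong l (λ _ → K.refl) λ j<m → K.sym (u≐v j<m))))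
                 (λ j → - v (l ℕ.+ j)))
               (tail-count st))

    pivot-state : ∀ x → ¬ Span W S (next r x) → State (suc D) (next r x) S
    pivot-state x r∉ = record
      { independent = r∉ ∷ independent st
      ; shift-span  = next-shift-span x st
      ; tail-count  = ≡.trans
          (tailCount-∷ l m (offset x)
            (span-resp (λ j<W → K.trans (solve 2 (λ n v → (:- v) := (n :- v) :- n) K.refl _ _)
                                        (+-congʳ (K.sym (next-lift x j<W))))
                       (span-resp (λ _ → -1*x≈-x _) (span-* (- 1#) v∈)))
            r∉)
          (≡.cong (q ℕ.*_) (tail-count st))
      }
      where open import Algebra.Properties.Ring ring using (-1*x≈-x)

    shift-closed : ∀ {s} → Span W S s → Span l S (shifted s)
    shift-closed (sub t s) = span-resp (λ _ → solve 3 (λ s t r → (s :- t :* r) :+ t :* r := s) K.refl _ t _)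
      (span-+* t (shift-span st s) c∈)

    -- The span is stable under shifting by m and contains the last m unit
    -- vectors, hence everything.
    saturated : D ≡ m → ∀ v → Span W S v
    saturated D≡m v = descend l vanishing-prefix v λ ()
      where
      Contains : ℕ → Set _
      Contains b = ∀ v → v ≐[ b ] 0ˢ → Span W S v

      vanishing-prefix : Contains l
      vanishing-prefix v v≐0 = span-resp
        (λ j<W → K.sym (splice-unique l v≐0 (λ _ → K.refl) j<W))
        (sumF^-full⇒∀ (λ u → span? W S (splice l 0ˢ u)) m
          (λ u≐v → span-resp (splice-cong l (λ _ → K.refl) u≐v))
          (≡.trans (tail-count st) (≡.cong (q ℕ.^_) D≡m)) (λ j → v (l ℕ.+ j)))

      delayed-vanishes : ∀ {b v} → v ≐[ b ] 0ˢ → splice m 0ˢ v ≐[ suc b ] 0ˢ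
      delayed-vanishes {b} {v} v≐0 {j} j<1+b with ℕ.<-≤-connex j m
      ... | inj₁ j<m = splice-prefix m 0ˢ v j<m
      ... | inj₂ m≤j with i , ≡.refl ← ℕ.m≤n⇒∃[o]m+o≡n m≤j =
        K.trans (K.reflexive (splice-+ m 0ˢ v i)) (v≐0 (ℕ.≤-<-trans (ℕ.m≤n+m i n) (ℕ.s<s⁻¹ j<1+b)))

      -- Delaying `v` by `m` gains a leading zero, so the delayed vector is in the span.
      -- `shift-closed` brings back the first `l` entries of `v`, and the remaining difference lies
      -- in E.
      step : ∀ {b} → Contains (suc b) → Contains b
      step C v v≐0 with v′ , v′≐v , v′∈ ← span-extend (span-resp (λ {j} _ → K.reflexive (splice-+ m 0ˢ v j))
                                             (shift-closed (C (splice m 0ˢ v) (delayed-vanishes v≐0)))) =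
        span-resp (λ _ → K.trans (+-congˡ (*-identityˡ _)) (solve 2 (λ a b → (a :- b) :+ b := a) K.refl _ _))
          (span-+* 1# (vanishing-prefix (λ j → v j - v′ j)
             (λ j<l → K.trans (+-congˡ (-‿cong (v′≐v j<l))) (-‿inverseʳ _))) (v′∈ W))

      descend : ∀ b → Contains b → Contains 0
      descend zero    C = C
      descend (suc b) C = descend b (step C)

  spanning⇒length : ∀ {R} → Independent W R → (∀ v → Span W R v) → length R ≡ W
  spanning⇒length {R} ri all = q^-injective (≡.trans (≡.sym (tailCount-independent ri))
    (sumF^-all (λ u → span? W R (splice 0 0ˢ u)) W λ u → all _))

  length⇒spanning : ∀ {R} → Independent W R → length R ≡ W → ∀ v → Span W R v
  length⇒spanning {R} ri len = sumF^-full⇒∀ (λ u → span? W R (splice 0 0ˢ u)) W span-resp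
    (≡.trans (tailCount-independent ri) (≡.cong (q ℕ.^_) len))

  -- The powers of q on both sides avoid the subtraction j - e in the exponent.
  completions-count : ∀ j {D r R} e → State D r R → suc (length R) ℕ.+ j ≡ W → D ℕ.+ e ≡ m →
                      completions j r R ℕ.* q ℕ.^ (e ℕ.* m) ≡ admissible q m e ℕ.* q ℕ.^ (j ℕ.* m)
  completions-count zero {D} {r} {R} e st len D+e≡m = ≡.trans
    (≡.cong₂ (λ x y → x ℕ.* q ℕ.^ (y ℕ.* m))
      (indicator-yes (nonsingular? (r ∷ R)) (independent⇒minor≉0 (independent st) len′)) e≡0)
    (≡.cong (λ y → admissible q m y ℕ.* 1) (≡.sym e≡0))
    where
    len′ = ≡.trans (≡.sym (ℕ.+-identityʳ _)) len

    D≡m : D ≡ m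
    D≡m = q^-injective (≡.trans (≡.sym (tail-count st))
      (sumF^-all (λ u → span? W (r ∷ R) (splice l 0ˢ u)) m λ u → length⇒spanning (independent st) len′ _))

    e≡0 : e ≡ 0
    e≡0 = ℕ.+-cancelˡ-≡ D e 0 (≡.trans D+e≡m (≡.trans (≡.sym D≡m) (≡.sym (ℕ.+-identityʳ D))))
  completions-count (suc j) {D} {r} {R} e st len D+e≡m with span? l (r ∷ R) (shifted r)
  ... | no c∉ = begin
    completions (suc j) r R ℕ.* q ℕ.^ (e ℕ.* m)
      ≡⟨ ≡.cong (ℕ._* q ℕ.^ (e ℕ.* m)) (completions-suc j r R) ⟩
    sumF^ m (λ x → completions j (next r x) (r ∷ R)) ℕ.* q ℕ.^ (e ℕ.* m)
      ≡⟨ ℕ.*-comm _ (q ℕ.^ (e ℕ.* m)) ⟩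
    q ℕ.^ (e ℕ.* m) ℕ.* sumF^ m (λ x → completions j (next r x) (r ∷ R))
      ≡⟨ sumF^-* m (q ℕ.^ (e ℕ.* m)) (λ x → completions j (next r x) (r ∷ R)) ⟨
    sumF^ m (λ x → q ℕ.^ (e ℕ.* m) ℕ.* completions j (next r x) (r ∷ R))
      ≡⟨ sumF^-cong m (λ x → ≡.trans (ℕ.*-comm (q ℕ.^ (e ℕ.* m)) (completions j (next r x) (r ∷ R)))
           (completions-count j e (fresh-state st c∉ x) (≡.trans (≡.cong suc (≡.sym (ℕ.+-suc _ j))) len) D+e≡m)) ⟩
    sumF^ m (λ _ → admissible q m e ℕ.* q ℕ.^ (j ℕ.* m))
      ≡⟨ sumF^-const m _ ⟩
    q ℕ.^ m ℕ.* (admissible q m e ℕ.* q ℕ.^ (j ℕ.* m))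
      ≡⟨ solveℕ 3 (λ a b c → a ⊗ (b ⊗ c) ⊜ b ⊗ (a ⊗ c)) ≡.refl (q ℕ.^ m) (admissible q m e) (q ℕ.^ (j ℕ.* m)) ⟩
    admissible q m e ℕ.* (q ℕ.^ m ℕ.* q ℕ.^ (j ℕ.* m))
      ≡⟨ ≡.cong (admissible q m e ℕ.*_) (ℕ.^-distribˡ-+-* q m (j ℕ.* m)) ⟨
    admissible q m e ℕ.* q ℕ.^ (suc j ℕ.* m) ∎
    where
    open ≡-Reasoning
  -- Here D = m, so `saturated` would make the independent rows span everything; there would be `W`
  -- of them, but `suc j` are still missing.
  completions-count (suc j) {D} {r} {R} zero st len D+e≡m | yes c∈ = contradiction
    (≡.trans (spanning⇒length (independent st) (saturated st c∈ (≡.trans (≡.sym (ℕ.+-identityʳ D)) D+e≡m)))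
             (≡.trans (≡.sym len) (ℕ.+-suc (suc (length R)) j)))
    (ℕ.m≢1+m+n (suc (length R)))
  completions-count (suc j) {D} {r} {R} (suc e) st len D+e≡m | yes c∈ = begin
    completions (suc j) r R ℕ.* q ℕ.^ (m ℕ.+ e ℕ.* m)
      ≡⟨ ≡.cong₂ ℕ._*_ (completions-suc j r R) (ℕ.^-distribˡ-+-* q m (e ℕ.* m)) ⟩
    sumF^ m (λ x → completions j (next r x) (r ∷ R)) ℕ.* (q ℕ.^ m ℕ.* q ℕ.^ (e ℕ.* m))
      ≡⟨ solveℕ 3 (λ a b c → a ⊗ (b ⊗ c) ⊜ b ⊗ (c ⊗ a)) ≡.refl _ (q ℕ.^ m) (q ℕ.^ (e ℕ.* m)) ⟩
    q ℕ.^ m ℕ.* (q ℕ.^ (e ℕ.* m) ℕ.* sumF^ m (λ x → completions j (next r x) (r ∷ R)))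
      ≡⟨ ≡.cong (q ℕ.^ m ℕ.*_) (sumF^-* m (q ℕ.^ (e ℕ.* m)) (λ x → completions j (next r x) (r ∷ R))) ⟨
    q ℕ.^ m ℕ.* sumF^ m (λ x → q ℕ.^ (e ℕ.* m) ℕ.* completions j (next r x) (r ∷ R))
      ≡⟨ ≡.cong (q ℕ.^ m ℕ.*_) (sumF^-cong m each) ⟩
    q ℕ.^ m ℕ.* sumF^ m (λ x → K′ ℕ.* indicator (¬? (span? W (r ∷ R) (next r x))))
      ≡⟨ ≡.cong (q ℕ.^ m ℕ.*_) (sumF^-* m K′ (λ x → indicator (¬? (span? W (r ∷ R) (next r x))))) ⟩
    q ℕ.^ m ℕ.* (K′ ℕ.* sumF^ m (λ x → indicator (¬? (span? W (r ∷ R) (next r x)))))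
      ≡⟨ ≡.cong (λ y → q ℕ.^ m ℕ.* (K′ ℕ.* y)) independent-count ⟩
    q ℕ.^ m ℕ.* (admissible q m e ℕ.* q ℕ.^ (j ℕ.* m) ℕ.* (q ℕ.^ m ℕ.∸ q ℕ.^ (m ℕ.∸ suc e)))
      ≡⟨ solveℕ 4 (λ a b c d → a ⊗ (b ⊗ c ⊗ d) ⊜ (d ⊗ b) ⊗ (a ⊗ c)) ≡.refl (q ℕ.^ m) (admissible q m e) (q ℕ.^ (j ℕ.* m)) _ ⟩
    admissible q m (suc e) ℕ.* (q ℕ.^ m ℕ.* q ℕ.^ (j ℕ.* m))
      ≡⟨ ≡.cong (admissible q m (suc e) ℕ.*_) (ℕ.^-distribˡ-+-* q m (j ℕ.* m)) ⟨
    admissible q m (suc e) ℕ.* q ℕ.^ (suc j ℕ.* m) ∎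
    where
    open ≡-Reasoning
    -- By induction, the scaled number of completions after any independent choice of the row.
    K′ = admissible q m e ℕ.* q ℕ.^ (j ℕ.* m)

    each : ∀ x → q ℕ.^ (e ℕ.* m) ℕ.* completions j (next r x) (r ∷ R) ≡
                 K′ ℕ.* indicator (¬? (span? W (r ∷ R) (next r x)))
    each x with span? W (r ∷ R) (next r x)
    ... | yes r∈ = ≡.trans (≡.cong (q ℕ.^ (e ℕ.* m) ℕ.*_) (completions-dependent j r∈))
                           (≡.trans (ℕ.*-zeroʳ (q ℕ.^ (e ℕ.* m))) (≡.sym (ℕ.*-zeroʳ K′)))
    ... | no  r∉ = ≡.trans (ℕ.*-comm (q ℕ.^ (e ℕ.* m)) (completions j (next r x) (r ∷ R))) (≡.trans
      (completions-count j e (pivot-state st c∈ x r∉) (≡.trans (≡.cong suc (≡.sym (ℕ.+-suc _ j))) len)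
                         (≡.trans (≡.sym (ℕ.+-suc D e)) D+e≡m))
      (≡.sym (ℕ.*-identityʳ K′)))

    independent-count : sumF^ m (λ x → indicator (¬? (span? W (r ∷ R) (next r x)))) ≡
                        q ℕ.^ m ℕ.∸ q ℕ.^ (m ℕ.∸ suc e)
    independent-count = ≡.trans (≡.sym (ℕ.m+n∸m≡n (q ℕ.^ D) _)) (≡.cong₂ ℕ._∸_
      (≡.trans (≡.cong (ℕ._+ _) (≡.sym (next-dependent-count st c∈))) (sumF^-¬ (λ x → span? W (r ∷ R) (next r x)) m))
      (≡.cong (q ℕ.^_) (≡.trans (≡.sym (ℕ.m+n∸n≡m D (suc e))) (≡.cong (ℕ._∸ suc e) D+e≡m))))

  -- D = 1 because the line spanned by `r` lies in E; the entry at `h` shows that it is not zero.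
  initial-state : ∀ {r h} → r ≐[ l ] 0ˢ → h < W → ¬ r h ≈ 0# → State 1 r []
  initial-state {r} {h} r≐0 h<W rh≉0 = record
    { independent = r∉ ∷ []
    ; shift-span  = λ { ([] s≐0) → span-0 (r ∷ []) λ j<l → s≐0 (m+<W j<l) }
    ; tail-count  = ≡.trans
        (tailCount-∷ l m (λ j → r (l ℕ.+ j))
          ([] λ j<W → K.trans (+-congʳ (K.sym (splice-unique l r≐0 (λ _ → K.refl) j<W))) (-‿inverseʳ _)) r∉)
        (≡.cong (q ℕ.*_) (≡.trans
          (sumF^-cong m λ u → indicator-cong (span? W [] _) (all0? u)
            (λ { ([] h) {j} j<m → K.trans (K.reflexive (≡.sym (splice-+ l 0ˢ u j))) (h (ℕ.+-monoʳ-< l j<m)) })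
            (λ u≐0 → [] λ j<W → K.sym (splice-unique l (λ _ → K.refl) (λ j<m → K.sym (u≐0 j<m)) j<W)))
          (sumF^-≐0 m all0?)))
    }
    where
    r∉ : ¬ Span W [] r
    r∉ ([] r≐0) = rh≉0 (r≐0 h<W)

    all0? : ∀ (z : Seq) → Dec (z ≐[ m ] 0ˢ)
    all0? z = ℕ.allUpTo? (λ j → z j ≟ 0#) m

-- Rational arithmetic and the Euler product.

open import Data.Integer.Base as ℤ using (ℤ; +_; _⊖_) renaming (_≤_ to _≤ℤ_)
import Data.Integer.Properties as ℤ
open import Data.Rational.Base as ℚ using (ℚ; 1ℚ; _-_)
import Data.Rational.Properties as ℚ
import Data.Rational.Unnormalised.Base as ℚᵘ
import Data.Rational.Unnormalised.Properties as ℚᵘ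
open import Algebra.Properties.Monoid.Sum ℚ.*-1-monoid using ()
  renaming (sum-init-last to product-init-last; sum-cong-≗ to product-cong-≗)

fromNat : ℕ → ℚ
fromNat a = + a ℚ./ 1

-- Normalised fractions involve a gcd, so the identity is checked on unnormalised ones, where it is
-- a cross multiplication of integers.
fraction-* : ∀ a b .{{_ : NonZero b}} → (+ a ℚ./ b) ℚ.* fromNat b ≡ fromNat a
fraction-* a b@(suc d) = ℚ.toℚᵘ-injective (begin
  ℚ.toℚᵘ ((+ a ℚ./ b) ℚ.* fromNat b)
    ≈⟨ ℚ.toℚᵘ-homo-* (+ a ℚ./ b) (fromNat b) ⟩
  ℚ.toℚᵘ (+ a ℚ./ b) ℚᵘ.* ℚ.toℚᵘ (fromNat b)
    ≈⟨ ℚᵘ.*-cong (ℚ.toℚᵘ-fromℚᵘ (ℚᵘ.mkℚᵘ (+ a) d)) (ℚ.toℚᵘ-fromℚᵘ (ℚᵘ.mkℚᵘ (+ b) 0)) ⟩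
  ℚᵘ.mkℚᵘ (+ a) d ℚᵘ.* ℚᵘ.mkℚᵘ (+ b) 0
    ≈⟨ ℚᵘ.*≡* (ℤ.*-assoc (+ a) (+ b) (+ 1)) ⟩
  ℚᵘ.mkℚᵘ (+ a) 0
    ≈⟨ ℚ.toℚᵘ-fromℚᵘ (ℚᵘ.mkℚᵘ (+ a) 0) ⟨
  ℚ.toℚᵘ (fromNat a) ∎)
  where open ℚᵘ.≃-Reasoning

fromNat-+ : ∀ a b → fromNat (a ℕ.+ b) ≡ fromNat a ℚ.+ fromNat b
fromNat-+ a b = ℚ.toℚᵘ-injective (begin
  ℚ.toℚᵘ (fromNat (a ℕ.+ b))                    ≈⟨ ℚ.toℚᵘ-fromℚᵘ (ℚᵘ.mkℚᵘ (+ (a ℕ.+ b)) 0) ⟩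
  ℚᵘ.mkℚᵘ (+ (a ℕ.+ b)) 0
    ≈⟨ ℚᵘ.*≡* (≡.cong (ℤ._* + 1) (≡.cong₂ ℤ._+_ (≡.sym (ℤ.*-identityʳ (+ a))) (≡.sym (ℤ.*-identityʳ (+ b))))) ⟩
  ℚᵘ.mkℚᵘ (+ a) 0 ℚᵘ.+ ℚᵘ.mkℚᵘ (+ b) 0
    ≈⟨ ℚᵘ.+-cong (ℚ.toℚᵘ-fromℚᵘ (ℚᵘ.mkℚᵘ (+ a) 0)) (ℚ.toℚᵘ-fromℚᵘ (ℚᵘ.mkℚᵘ (+ b) 0)) ⟨
  ℚ.toℚᵘ (fromNat a) ℚᵘ.+ ℚ.toℚᵘ (fromNat b)    ≈⟨ ℚ.toℚᵘ-homo-+ (fromNat a) (fromNat b) ⟨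
  ℚ.toℚᵘ (fromNat a ℚ.+ fromNat b)              ∎)
  where open ℚᵘ.≃-Reasoning

fromNat-* : ∀ a b → fromNat (a ℕ.* b) ≡ fromNat a ℚ.* fromNat b
fromNat-* a b = ℚ.toℚᵘ-injective (begin
  ℚ.toℚᵘ (fromNat (a ℕ.* b))                    ≈⟨ ℚ.toℚᵘ-fromℚᵘ (ℚᵘ.mkℚᵘ (+ (a ℕ.* b)) 0) ⟩
  ℚᵘ.mkℚᵘ (+ (a ℕ.* b)) 0                       ≈⟨ ℚᵘ.*≡* (≡.cong (ℤ._* + 1) (ℤ.pos-* a b)) ⟩
  ℚᵘ.mkℚᵘ (+ a) 0 ℚᵘ.* ℚᵘ.mkℚᵘ (+ b) 0
    ≈⟨ ℚᵘ.*-cong (ℚ.toℚᵘ-fromℚᵘ (ℚᵘ.mkℚᵘ (+ a) 0)) (ℚ.toℚᵘ-fromℚᵘ (ℚᵘ.mkℚᵘ (+ b) 0)) ⟨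
  ℚ.toℚᵘ (fromNat a) ℚᵘ.* ℚ.toℚᵘ (fromNat b)    ≈⟨ ℚ.toℚᵘ-homo-* (fromNat a) (fromNat b) ⟨
  ℚ.toℚᵘ (fromNat a ℚ.* fromNat b)              ∎)
  where open ℚᵘ.≃-Reasoning

module ℚSolver = DifferenceSolver ℚ.+-*-commutativeRing
open ℚSolver using (solve; _:=_; _:+_; _:*_; _:-_)

fromNat-∸ : ∀ {a b} → b ≤ a → fromNat (a ℕ.∸ b) ≡ fromNat a ℚ.- fromNat b
fromNat-∸ {a} {b} b≤a = begin
  fromNat (a ℕ.∸ b)                                  ≡⟨ solve 2 (λ x y → x := (x :+ y) :- y) ≡.refl _ (fromNat b) ⟩
  (fromNat (a ℕ.∸ b) ℚ.+ fromNat b) ℚ.- fromNat b    ≡⟨ ≡.cong (ℚ._- fromNat b) (fromNat-+ (a ℕ.∸ b) b) ⟨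
  fromNat (a ℕ.∸ b ℕ.+ b) ℚ.- fromNat b              ≡⟨ ≡.cong (λ x → fromNat x ℚ.- fromNat b) (ℕ.m∸n+n≡m b≤a) ⟩
  fromNat a ℚ.- fromNat b                            ∎
  where open ≡-Reasoning

fromNat-cancel : ∀ b .{{_ : NonZero b}} {x y} → x ℚ.* fromNat b ≡ y ℚ.* fromNat b → x ≡ y
fromNat-cancel b {x} {y} eq = begin
  x                                      ≡⟨ expand x ⟩
  x ℚ.* fromNat b ℚ.* (+ 1 ℚ./ b)        ≡⟨ ≡.cong (ℚ._* (+ 1 ℚ./ b)) eq ⟩
  y ℚ.* fromNat b ℚ.* (+ 1 ℚ./ b)        ≡⟨ expand y ⟨
  y                                      ∎
  where
  open ≡-Reasoning
  expand : ∀ x → x ≡ x ℚ.* fromNat b ℚ.* (+ 1 ℚ./ b)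
  expand x = ≡.sym (≡.trans (ℚ.*-assoc x _ _) (≡.trans
    (≡.cong (x ℚ.*_) (≡.trans (ℚ.*-comm (fromNat b) _) (fraction-* 1 b))) (ℚ.*-identityʳ x)))

-- `c` counts the complement, and `E` is its proportion with the denominator cleared. Nonemptiness
-- excludes the dummy value of `proportion`.
proportion-complement : ∀ {a p} {A : Set a} {P : Pred A p} (P? : Decidable P) xs c {E} → NonZero (length xs) →
  length (filter P? xs) ℕ.+ c ≡ length xs → E ℚ.* fromNat (length xs) ≡ fromNat c →
  proportion P? xs ≡ 1ℚ ℚ.- E
proportion-complement P? xs@(_ ∷ _) c {E} _ total complement = fromNat-cancel (length xs) (begin
  (+ a ℚ./ length xs) ℚ.* fromNat (length xs)    ≡⟨ fraction-* a (length xs) ⟩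
  fromNat a                                      ≡⟨ solve 2 (λ x y → x := (x :+ y) :- y) ≡.refl _ (fromNat c) ⟩
  (fromNat a ℚ.+ fromNat c) ℚ.- fromNat c        ≡⟨ ≡.cong (ℚ._- fromNat c) (fromNat-+ a c) ⟨
  fromNat (a ℕ.+ c) ℚ.- fromNat c                ≡⟨ ≡.cong₂ (λ x y → fromNat x ℚ.- y) total (≡.sym complement) ⟩
  fromNat (length xs) ℚ.- E ℚ.* fromNat (length xs)
    ≡⟨ ≡.cong (ℚ._- E ℚ.* fromNat (length xs)) (ℚ.*-identityˡ (fromNat (length xs))) ⟨
  1ℚ ℚ.* fromNat (length xs) ℚ.- E ℚ.* fromNat (length xs)
    ≡⟨ solve 3 (λ o e x → o :* x :- e :* x := (o :- e) :* x) ≡.refl 1ℚ E _ ⟩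
  (1ℚ ℚ.- E) ℚ.* fromNat (length xs)             ∎)
  where
  open ≡-Reasoning
  a = length (filter P? xs)

module _ (q : ℕ) .{{nz : NonZero q}} where
  eulerFactor : ℕ → ℚ
  eulerFactor e = 1ℚ ℚ.- ((+ 1) ℚ./ (q ℕ.^ suc e)) {{ℕ.m^n≢0 q (suc e)}}

  eulerProduct-suc : ∀ e → eulerProduct q (suc e) ≡ eulerProduct q e ℚ.* eulerFactor e
  eulerProduct-suc e = ≡.trans (product-init-last {e} (eulerFactor ∘ toℕ)) (≡.cong₂ ℚ._*_
    (product-cong-≗ {e} λ i → ≡.cong eulerFactor (Fin.toℕ-inject₁ i)) (≡.cong eulerFactor (Fin.toℕ-fromℕ e)))

  -- With i = e + 1, the factor 1 - q^(-i) belongs to the row that raises D from m - i, for which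
  -- q^m - q^(m - i) of the q^m choices are independent.
  eulerFactor-* : ∀ {e m} → suc e ≤ m →
                  eulerFactor e ℚ.* fromNat (q ℕ.^ m) ≡ fromNat (q ℕ.^ m ℕ.∸ q ℕ.^ (m ℕ.∸ suc e))
  eulerFactor-* {e} {m} e<m = begin
    (1ℚ ℚ.- inv) ℚ.* fromNat (q ℕ.^ m)
      ≡⟨ solve 3 (λ o i x → (o :- i) :* x := o :* x :- i :* x) ≡.refl 1ℚ inv _ ⟩
    1ℚ ℚ.* fromNat (q ℕ.^ m) ℚ.- inv ℚ.* fromNat (q ℕ.^ m)
      ≡⟨ ≡.cong₂ ℚ._-_ (ℚ.*-identityˡ (fromNat (q ℕ.^ m))) tail ⟩
    fromNat (q ℕ.^ m) ℚ.- fromNat (q ℕ.^ (m ℕ.∸ suc e))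
      ≡⟨ fromNat-∸ (ℕ.^-monoʳ-≤ q (ℕ.m∸n≤m m (suc e))) ⟨
    fromNat (q ℕ.^ m ℕ.∸ q ℕ.^ (m ℕ.∸ suc e)) ∎
    where
    open ≡-Reasoning
    instance q^1+e≢0 = ℕ.m^n≢0 q (suc e)
    inv = (+ 1) ℚ./ (q ℕ.^ suc e)

    tail : inv ℚ.* fromNat (q ℕ.^ m) ≡ fromNat (q ℕ.^ (m ℕ.∸ suc e))
    tail = begin
      inv ℚ.* fromNat (q ℕ.^ m)
        ≡⟨ ≡.cong (λ x → inv ℚ.* fromNat (q ℕ.^ x)) (ℕ.m+[n∸m]≡n e<m) ⟨
      inv ℚ.* fromNat (q ℕ.^ (suc e ℕ.+ (m ℕ.∸ suc e)))
        ≡⟨ ≡.cong (λ x → inv ℚ.* fromNat x) (ℕ.^-distribˡ-+-* q (suc e) (m ℕ.∸ suc e)) ⟩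
      inv ℚ.* fromNat (q ℕ.^ suc e ℕ.* q ℕ.^ (m ℕ.∸ suc e))
        ≡⟨ ≡.cong (inv ℚ.*_) (fromNat-* (q ℕ.^ suc e) (q ℕ.^ (m ℕ.∸ suc e))) ⟩
      inv ℚ.* (fromNat (q ℕ.^ suc e) ℚ.* fromNat (q ℕ.^ (m ℕ.∸ suc e)))
        ≡⟨ ℚ.*-assoc inv _ _ ⟨
      inv ℚ.* fromNat (q ℕ.^ suc e) ℚ.* fromNat (q ℕ.^ (m ℕ.∸ suc e))
        ≡⟨ ≡.cong (ℚ._* fromNat (q ℕ.^ (m ℕ.∸ suc e))) (fraction-* 1 (q ℕ.^ suc e)) ⟩
      1ℚ ℚ.* fromNat (q ℕ.^ (m ℕ.∸ suc e))
        ≡⟨ ℚ.*-identityˡ _ ⟩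
      fromNat (q ℕ.^ (m ℕ.∸ suc e)) ∎

  eulerProduct-* : ∀ {m} e → e ≤ m → eulerProduct q e ℚ.* fromNat (q ℕ.^ (e ℕ.* m)) ≡ fromNat (admissible q m e)
  eulerProduct-* zero    _   = ≡.refl
  eulerProduct-* {m} (suc e) e<m = begin
    eulerProduct q (suc e) ℚ.* fromNat (q ℕ.^ (m ℕ.+ e ℕ.* m))
      ≡⟨ ≡.cong₂ ℚ._*_ (eulerProduct-suc e) (≡.trans (≡.cong fromNat (ℕ.^-distribˡ-+-* q m (e ℕ.* m)))
                                                      (fromNat-* (q ℕ.^ m) (q ℕ.^ (e ℕ.* m)))) ⟩
    eulerProduct q e ℚ.* eulerFactor e ℚ.* (fromNat (q ℕ.^ m) ℚ.* fromNat (q ℕ.^ (e ℕ.* m)))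
      ≡⟨ solve 4 (λ a b c d → a :* b :* (c :* d) := (b :* c) :* (a :* d)) ≡.refl (eulerProduct q e) (eulerFactor e) _ _ ⟩
    (eulerFactor e ℚ.* fromNat (q ℕ.^ m)) ℚ.* (eulerProduct q e ℚ.* fromNat (q ℕ.^ (e ℕ.* m)))
      ≡⟨ ≡.cong₂ ℚ._*_ (eulerFactor-* e<m) (eulerProduct-* e (ℕ.<⇒≤ e<m)) ⟩
    fromNat (q ℕ.^ m ℕ.∸ q ℕ.^ (m ℕ.∸ suc e)) ℚ.* fromNat (admissible q m e)
      ≡⟨ fromNat-* (q ℕ.^ m ℕ.∸ q ℕ.^ (m ℕ.∸ suc e)) (admissible q m e) ⟨
    fromNat (admissible q m (suc e)) ∎
    where open ≡-Reasoning

-- From lists of tuples to sums.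

length-filter-sum : ∀ {a p} {A : Set a} {P : Pred A p} (P? : Decidable P) xs →
                    length (filter P? xs) ≡ sumL (List.map (indicator ∘ P?) xs)
length-filter-sum P? []       = ≡.refl
length-filter-sum P? (x ∷ xs) with P? x
... | yes _ = ≡.cong suc (length-filter-sum P? xs)
... | no  _ = length-filter-sum P? xs

length-sum : ∀ {a} {A : Set a} (xs : List A) → length xs ≡ sumL (List.map (λ _ → 1) xs)
length-sum []       = ≡.refl
length-sum (x ∷ xs) = ≡.cong suc (length-sum xs)

sum-map-tabulate : ∀ {a b} {A : Set a} {B : Set b} (h : B → ℕ) (f : A → B) {n} (g : Fin n → A) →
  sumL (List.map h (List.map f (tabulate g))) ≡ sum (h ∘ f ∘ g)
sum-map-tabulate h f {zero}  g = ≡.refl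
sum-map-tabulate h f {suc n} g = ≡.cong (h (f (g zero)) ℕ.+_) (sum-map-tabulate h f (g ∘ suc))

sum-cartesianProductWith : ∀ {a b c} {A : Set a} {B : Set b} {C : Set c} (h : C → ℕ) (f : A → B → C) xs ys →
  sumL (List.map h (cartesianProductWith f xs ys)) ≡ sumL (List.map (λ x → sumL (List.map (h ∘ f x) ys)) xs)
sum-cartesianProductWith h f []       ys = ≡.refl
sum-cartesianProductWith h f (x ∷ xs) ys = begin
  sumL (List.map h (List.map (f x) ys List.++ cartesianProductWith f xs ys))
    ≡⟨ ≡.cong sumL (map-++ h (List.map (f x) ys) _) ⟩
  sumL (List.map h (List.map (f x) ys) List.++ List.map h (cartesianProductWith f xs ys))
    ≡⟨ sum-++ (List.map h (List.map (f x) ys)) _ ⟩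
  sumL (List.map h (List.map (f x) ys)) ℕ.+ sumL (List.map h (cartesianProductWith f xs ys))
    ≡⟨ ≡.cong₂ ℕ._+_ (≡.cong sumL (≡.sym (map-∘ ys))) (sum-cartesianProductWith h f xs ys) ⟩
  sumL (List.map (h ∘ f x) ys) ℕ.+ sumL (List.map (λ x → sumL (List.map (h ∘ f x) ys)) xs) ∎
  where open ≡-Reasoning

module Tuples {c ℓ q} (F : FiniteField c ℓ q) where
  open FiniteField F hiding (zero; refl; trans; sym)
  private module K = FiniteField F
  open LinearAlgebra F
  open Counting F

  -- `h` and `g` are separate because padding a longer vector agrees with `x ◂` the padded rest only
  -- pointwise.
  sum-tuples : ∀ N {W} (h : Vec Carrier N → ℕ) (g : Seq → ℕ) → Respects W g →
               (∀ v → h v ≡ g (padded commutativeRing v)) → sumL (List.map h (tuples N)) ≡ sumF^ N g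
  sum-tuples zero    h g resp eq = ≡.trans (ℕ.+-identityʳ _) (eq Vec.[])
  sum-tuples (suc N) {W} h g resp eq = ≡.trans (sum-cartesianProductWith h Vec._∷_ elements (tuples N)) (≡.trans
    (sum-map-tabulate (λ x → sumL (List.map (h ∘ (x Vec.∷_)) (tuples N))) (Inverse.from index) id)
    (sumF-cong λ x → sum-tuples N (h ∘ (x Vec.∷_)) (λ z → g (x ◂ z))
      (λ u≐v → resp (λ {j} j<W → ◂-cong {W} K.refl u≐v (ℕ.m<n⇒m<1+n j<W)))
      λ v → ≡.trans (eq (x Vec.∷ v)) (resp
        (≐-cases (padded commutativeRing (x Vec.∷ v)) (x ◂ padded commutativeRing v) K.refl λ _ → K.refl))))

  length-tuples : ∀ N → length (tuples N) ≡ q ℕ.^ N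
  length-tuples N = ≡.trans (length-sum (tuples N)) (≡.trans
    (sum-tuples N {0} (λ _ → 1) (λ _ → 1) (λ _ → ≡.refl) λ _ → ≡.refl)
    (≡.trans (sumF^-const N 1) (ℕ.*-identityʳ _)))

  -- Accounts for the entries of a tuple beyond the largest subscript in the matrix.
  sumF^-extra : ∀ a b {g} → Respects a g → sumF^ (a ℕ.+ b) g ≡ q ℕ.^ b ℕ.* sumF^ a g
  sumF^-extra a b {g} resp = ≡.trans (sumF^-split a resp) (≡.trans
    (sumF^-cong a λ x → ≡.trans
      (sumF^-cong b λ y → resp {splice a x y} {x} λ i<a → K.reflexive (splice-< x y i<a))
      (sumF^-const b (g x)))
    (sumF^-* a (q ℕ.^ b) g))

-- The Jacobi-Trudi matrix as windows on one sequence.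

-- `h` is the column, counted from 0, of the entry z₀ = 1 in the bottom row; the equation says h = W
-- - 1 - p.
module JacobiTrudi {c ℓ q} (F : FiniteField c ℓ q) (l n p h : ℕ) (h+p : h ℕ.+ suc p ≡ l ℕ.+ suc n) where
  open FiniteField F hiding (zero; refl; trans; sym; _-_)
  private module K = FiniteField F
  open LinearAlgebra F
  open Counting F
  open Growth F l n

  -- The sequence 0, …, 0, 1, z₁, z₂, … with h zeros.
  delayed : ℕ → Seq → Seq
  delayed zero    z zero    = 1#
  delayed zero    z (suc x) = z x
  delayed (suc h) z zero    = 0#
  delayed (suc h) z (suc x) = delayed h z x

  -- Turns the three cases of an integer subscript into a lookup in one sequence at a natural
  -- position.
  entry-⊖ : ∀ z x h → entry commutativeRing z (x ⊖ h) ≡ delayed h z x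
  entry-⊖ z zero    zero    = ≡.refl
  entry-⊖ z (suc x) zero    = ≡.refl
  entry-⊖ z zero    (suc h) = ≡.refl
  entry-⊖ z (suc x) (suc h) = ≡.trans (≡.cong (entry commutativeRing z) (ℤ.[1+m]⊖[1+n]≡m⊖n x h)) (entry-⊖ z x h)

  delayed-< : ∀ h z {x} → x < h → delayed h z x ≡ 0#
  delayed-< (suc h) z {zero}  _         = ≡.refl
  delayed-< (suc h) z {suc x} (s≤s x<h) = delayed-< h z x<h

  delayed-≡ : ∀ h z → delayed h z h ≡ 1#
  delayed-≡ zero    z = ≡.refl
  delayed-≡ (suc h) z = delayed-≡ h z

  delayed-+ : ∀ h z x → delayed h z (h ℕ.+ suc x) ≡ z x
  delayed-+ zero    z x = ≡.refl
  delayed-+ (suc h) z x = delayed-+ h z x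

  delayed-cong : ∀ h {b u v} → u ≐[ b ] v → delayed h u ≐[ h ℕ.+ suc b ] delayed h v
  delayed-cong zero    u≐v {zero}  _         = K.refl
  delayed-cong zero    u≐v {suc x} (s≤s x<b) = u≐v x<b
  delayed-cong (suc h) u≐v {zero}  _         = K.refl
  delayed-cong (suc h) u≐v {suc x} (s≤s x<)  = delayed-cong h u≐v x<

  row : Seq → ℕ → Seq
  row a t j = a (t ℕ.* m ℕ.+ j)

  rows : Seq → ℕ → List Seq
  rows a zero    = []
  rows a (suc t) = row a t ∷ rows a t

  tabulate-rows : ∀ a k → tabulate {n = k} (λ i → row a (k ℕ.∸ suc (toℕ i))) ≡ rows a k
  tabulate-rows a zero    = ≡.refl
  tabulate-rows a (suc k) = ≡.cong (row a k ∷_) (tabulate-rows a k)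

  ⊖-cong : ∀ {x i y h} → x ℕ.+ h ≡ y ℕ.+ i → x ⊖ i ≡ y ⊖ h
  ⊖-cong {x} {i} {y} {h} eq = begin
    x ⊖ i                      ≡⟨ ℤ.+-cancelˡ-⊖ h x i ⟨
    (h ℕ.+ x) ⊖ (h ℕ.+ i)      ≡⟨ ≡.cong₂ _⊖_ (≡.trans (ℕ.+-comm h x) (≡.trans eq (ℕ.+-comm y i))) (ℕ.+-comm h i) ⟩
    (i ℕ.+ y) ⊖ (i ℕ.+ h)      ≡⟨ ℤ.+-cancelˡ-⊖ i y h ⟩
    y ⊖ h                      ∎
    where open ≡-Reasoning

  -- With t = W - 1 - i, the row index is i = h + p - t; subtracting it cancels `p` and turns
  -- `t * n` into `t * m`.
  subscript-⊖ : ∀ (i j : Fin W) →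
    subscript (arithmeticPartition p n W) i j ≡ ((W ℕ.∸ suc (toℕ i)) ℕ.* m ℕ.+ toℕ j) ⊖ h
  subscript-⊖ i j = begin
    + (p ℕ.+ t ℕ.* n) ℤ.- + toℕ i ℤ.+ + toℕ j    ≡⟨ ≡.cong (ℤ._+ + toℕ j) (ℤ.m-n≡m⊖n (p ℕ.+ t ℕ.* n) (toℕ i)) ⟩
    (p ℕ.+ t ℕ.* n ⊖ toℕ i) ℤ.+ + toℕ j          ≡⟨ ℤ.distribˡ-⊖-+-pos (toℕ j) (p ℕ.+ t ℕ.* n) (toℕ i) ⟩
    (p ℕ.+ t ℕ.* n ℕ.+ toℕ j) ⊖ toℕ i            ≡⟨ ⊖-cong {p ℕ.+ t ℕ.* n ℕ.+ toℕ j} {toℕ i} {t ℕ.* m ℕ.+ toℕ j} {h} (begin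
      p ℕ.+ t ℕ.* n ℕ.+ toℕ j ℕ.+ h
        ≡⟨ solveℕ 4 (λ p h s j → p ⊕ s ⊕ j ⊕ h ⊜ (h ⊕ p) ⊕ (s ⊕ j)) ≡.refl p h (t ℕ.* n) (toℕ j) ⟩
      (h ℕ.+ p) ℕ.+ (t ℕ.* n ℕ.+ toℕ j)
        ≡⟨ ≡.cong (ℕ._+ (t ℕ.* n ℕ.+ toℕ j)) h+p≡t+i ⟩
      (t ℕ.+ toℕ i) ℕ.+ (t ℕ.* n ℕ.+ toℕ j)
        ≡⟨ solveℕ 4 (λ t n i j → (t ⊕ i) ⊕ (t ⊗ n ⊕ j) ⊜ t ⊗ (conℕ 1 ⊕ n) ⊕ j ⊕ i) ≡.refl t n (toℕ i) (toℕ j) ⟩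
      t ℕ.* m ℕ.+ toℕ j ℕ.+ toℕ i ∎) ⟩
    (t ℕ.* m ℕ.+ toℕ j) ⊖ h                      ∎
    where
    open ≡-Reasoning
    t = W ℕ.∸ suc (toℕ i)

    h+p≡t+i : h ℕ.+ p ≡ t ℕ.+ toℕ i
    h+p≡t+i = ℕ.suc-injective (≡.trans (≡.sym (ℕ.+-suc h p)) (≡.trans h+p
      (≡.trans (≡.sym (ℕ.m∸n+n≡m (Fin.toℕ<n i))) (ℕ.+-suc t (toℕ i)))))

  jacobiTrudiAt : Seq → Matrix Carrier W
  jacobiTrudiAt = jacobiTrudi commutativeRing (arithmeticPartition p n W)

  det≈minor-rows : ∀ z → det commutativeRing (jacobiTrudiAt z) ≈ minor (rows (delayed h z) W) columns
  det≈minor-rows z = K.trans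
    (det-cong λ i j → K.reflexive (≡.trans (≡.cong (entry commutativeRing z) (subscript-⊖ i j)) (entry-⊖ z _ h)))
    (K.trans (det≈minor {W} (λ i → row (delayed h z) (W ℕ.∸ suc (toℕ i))) toℕ)
             (K.reflexive (≡.cong (λ R → minor R columns) (tabulate-rows (delayed h z) W))))

  rows-cong : ∀ {a b M} k → a ≐[ M ] b → k ℕ.* m ℕ.+ W ≤ M → Pointwise _≐[ W ]_ (rows a k) (rows b k)
  rows-cong zero    a≐b _  = []
  rows-cong (suc k) a≐b le = (λ j<W → a≐b (ℕ.<-≤-trans (ℕ.+-monoʳ-< (k ℕ.* m) j<W) le′)) ∷ rows-cong k a≐b le′
    where le′ = ℕ.≤-trans (ℕ.+-monoˡ-≤ W (ℕ.m≤n+m (k ℕ.* m) m)) le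

  -- A generous bound: what matters is that only finitely many entries are read.
  nonsingular-rows-respects : Respects (W ℕ.* m ℕ.+ W) (λ z → nonsingular (rows (delayed h z) W))
  nonsingular-rows-respects u≐v = nonsingular-cong (rows-cong W (delayed-cong h u≐v)
    (ℕ.≤-trans (ℕ.n≤1+n _) (ℕ.m≤n+m (suc (W ℕ.* m ℕ.+ W)) h)))

  -- Row `t` stops just before position `t * m + W`, where the unread entries `z` begin. The next
  -- window overlaps it in `l` entries and takes `m` of these.
  grow-rows : ∀ a j t {r R z} → r ≐[ W ] row a t → Pointwise _≐[ W ]_ R (rows a t) →
              (∀ u → z u ≈ a (t ℕ.* m ℕ.+ W ℕ.+ u)) →
              Pointwise _≐[ W ]_ (grow j r R z) (rows a (suc (j ℕ.+ t)))
  grow-rows a zero    t r≐ R≐ z≈ = r≐ ∷ R≐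
  grow-rows a (suc j) t {r} {R} {z} r≐ R≐ z≈ =
    ≡.subst (λ s → Pointwise _≐[ W ]_ (grow j (next r z) (r ∷ R) (shifted z)) (rows a (suc s))) (ℕ.+-suc j t)
      (grow-rows a j (suc t)
        (λ j<W → K.sym (splice-unique l {w = row a (suc t)}
          (λ {i} i<l → K.trans (K.reflexive (≡.cong a
              (solveℕ 3 (λ m s i → m ⊕ s ⊕ i ⊜ s ⊕ (m ⊕ i)) ≡.refl m (t ℕ.* m) i)))
            (K.sym (r≐ (m+<W i<l))))
          (λ {u} _ → K.trans (K.reflexive (≡.cong a
              (solveℕ 4 (λ m s l u → m ⊕ s ⊕ (l ⊕ u) ⊜ s ⊕ (l ⊕ m) ⊕ u) ≡.refl m (t ℕ.* m) l u)))
            (K.sym (z≈ u))) j<W))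
        (r≐ ∷ R≐)
        (λ u → K.trans (z≈ (m ℕ.+ u)) (K.reflexive (≡.cong a
          (solveℕ 4 (λ m s w u → s ⊕ w ⊕ (m ⊕ u) ⊜ m ⊕ s ⊕ w ⊕ u) ≡.refl m (t ℕ.* m) W u)))))

  nonsingular-rows : ∀ {k} → suc k ≡ W → ∀ x y →
    nonsingular (rows (delayed h (splice p x y)) W) ≡ nonsingular (grow k (delayed h x) [] y)
  nonsingular-rows {k} 1+k≡W x y = ≡.sym (nonsingular-cong
    (≡.subst (λ s → Pointwise _≐[ W ]_ (grow k (delayed h x) [] y) (rows (delayed h (splice p x y)) s))
      (≡.trans (≡.cong suc (ℕ.+-identityʳ k)) 1+k≡W)
      (grow-rows (delayed h (splice p x y)) k 0
        (λ {j} j<W → delayed-cong h {p} (λ i<p → K.sym (splice-prefix p x y i<p)) (≡.subst (j <_) (≡.sym h+p) j<W))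
        []
        (λ u → K.reflexive (≡.sym (≡.trans
          (≡.cong (delayed h (splice p x y)) (≡.trans (≡.cong (ℕ._+ u) (≡.sym h+p)) (ℕ.+-assoc h (suc p) u)))
          (≡.trans (delayed-+ h (splice p x y) (p ℕ.+ u)) (splice-+ p x y u))))))))

  -- Here `k` is the number of rows above the bottom one. The bottom row reads `p` variables, each
  -- other row `m` new ones, and `rest` variables stay unread.
  nonsingular-count : ∀ {k} rest → suc k ≡ W → p ≤ n →
    sumF^ (p ℕ.+ (k ℕ.* m ℕ.+ rest)) (λ z → nonsingular (rows (delayed h z) W)) ℕ.* q ℕ.^ (n ℕ.* m) ≡
    admissible q m n ℕ.* q ℕ.^ (p ℕ.+ (k ℕ.* m ℕ.+ rest))
  nonsingular-count {k} rest 1+k≡W p≤n = begin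
    sumF^ (p ℕ.+ (k ℕ.* m ℕ.+ rest)) (λ z → nonsingular (rows (delayed h z) W)) ℕ.* Q
      ≡⟨ ≡.cong (ℕ._* Q) (sumF^-split p nonsingular-rows-respects) ⟩
    sumF^ p (λ x → sumF^ (k ℕ.* m ℕ.+ rest) λ y → nonsingular (rows (delayed h (splice p x y)) W)) ℕ.* Q
      ≡⟨ ≡.cong (ℕ._* Q) (sumF^-cong p λ x → ≡.trans
           (sumF^-cong (k ℕ.* m ℕ.+ rest) λ y → nonsingular-rows 1+k≡W x y)
           (sumF^-extra (k ℕ.* m) rest (nonsingular-respects k (delayed h x) []))) ⟩
    sumF^ p (λ x → q ℕ.^ rest ℕ.* completions k (delayed h x) []) ℕ.* Q
      ≡⟨ ℕ.*-comm _ Q ⟩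
    Q ℕ.* sumF^ p (λ x → q ℕ.^ rest ℕ.* completions k (delayed h x) [])
      ≡⟨ sumF^-* p Q (λ x → q ℕ.^ rest ℕ.* completions k (delayed h x) []) ⟨
    sumF^ p (λ x → Q ℕ.* (q ℕ.^ rest ℕ.* completions k (delayed h x) []))
      -- D starts at 1 whatever the first `p` variables are, which leaves `n` increments up to `m`.
      ≡⟨ sumF^-cong p (λ x → ≡.trans
           (solveℕ 3 (λ a b c → a ⊗ (b ⊗ c) ⊜ b ⊗ (c ⊗ a)) ≡.refl Q (q ℕ.^ rest) (completions k (delayed h x) []))
           (≡.cong (q ℕ.^ rest ℕ.*_) (completions-count k n (start x) 1+k≡W ≡.refl))) ⟩
    sumF^ p (λ _ → q ℕ.^ rest ℕ.* (admissible q m n ℕ.* q ℕ.^ (k ℕ.* m)))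
      ≡⟨ sumF^-const p _ ⟩
    q ℕ.^ p ℕ.* (q ℕ.^ rest ℕ.* (admissible q m n ℕ.* q ℕ.^ (k ℕ.* m)))
      ≡⟨ solveℕ 4 (λ a b c d → a ⊗ (b ⊗ (c ⊗ d)) ⊜ c ⊗ (a ⊗ (d ⊗ b))) ≡.refl
           (q ℕ.^ p) (q ℕ.^ rest) (admissible q m n) (q ℕ.^ (k ℕ.* m)) ⟩
    admissible q m n ℕ.* (q ℕ.^ p ℕ.* (q ℕ.^ (k ℕ.* m) ℕ.* q ℕ.^ rest))
      ≡⟨ ≡.cong (admissible q m n ℕ.*_) (≡.trans (ℕ.^-distribˡ-+-* q p (k ℕ.* m ℕ.+ rest))
           (≡.cong (q ℕ.^ p ℕ.*_) (ℕ.^-distribˡ-+-* q (k ℕ.* m) rest))) ⟨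
    admissible q m n ℕ.* q ℕ.^ (p ℕ.+ (k ℕ.* m ℕ.+ rest)) ∎
    where
    open ≡-Reasoning
    open Tuples F
    Q = q ℕ.^ (n ℕ.* m)

    -- This is where `p ≤ n` enters: the 1 of the bottom row lies beyond the first `l` columns.
    l≤h : l ≤ h
    l≤h = ℕ.+-cancelʳ-≤ (suc p) l h (≡.subst (l ℕ.+ suc p ≤_) (≡.sym h+p) (ℕ.+-monoʳ-≤ l (s≤s p≤n)))

    h<W : h < W
    h<W = ≡.subst (suc h ≤_) (≡.trans (≡.sym (ℕ.+-suc h p)) h+p) (s≤s (ℕ.m≤m+n h p))

    start : ∀ x → State 1 (delayed h x) []
    start x = initial-state (λ j<l → K.reflexive (delayed-< h x (ℕ.<-≤-trans j<l l≤h))) h<W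
      λ e → 0#≉1# (K.trans (K.sym e) (K.reflexive (delayed-≡ h x)))

  -- The top right corner carries the largest subscript, and the bound is applied there.
  lastSubscript : ∀ {k} → suc k ≡ W → ∀ {N} → (∀ i j → subscript (arithmeticPartition p n W) i j ≤ℤ + N) →
                  p ℕ.+ k ℕ.* m ≤ N
  lastSubscript {k} 1+k≡W {N} bound = drop (≡.subst (_≤ℤ + N) value (bound first last))
    where
    0<W : 0 < W
    0<W = ≡.subst (0 <_) 1+k≡W (s≤s z≤n)

    k<W : k < W
    k<W = ≡.subst (k <_) 1+k≡W ℕ.≤-refl

    first last : Fin W
    first = Fin.fromℕ< 0<W
    last  = Fin.fromℕ< k<W

    open ≡-Reasoning

    value : subscript (arithmeticPartition p n W) first last ≡ + (p ℕ.+ k ℕ.* m)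
    value = begin
      subscript (arithmeticPartition p n W) first last
        ≡⟨ ≡.cong₂ (λ i j → + (p ℕ.+ (W ℕ.∸ suc i) ℕ.* n) ℤ.- + i ℤ.+ + j) (Fin.toℕ-fromℕ< 0<W) (Fin.toℕ-fromℕ< k<W) ⟩
      + (p ℕ.+ (W ℕ.∸ 1) ℕ.* n ℕ.+ 0 ℕ.+ k)
        ≡⟨ ≡.cong (λ w → + (p ℕ.+ (w ℕ.∸ 1) ℕ.* n ℕ.+ 0 ℕ.+ k)) 1+k≡W ⟨
      + (p ℕ.+ k ℕ.* n ℕ.+ 0 ℕ.+ k)
        ≡⟨ ≡.cong +_ (solveℕ 3 (λ p k n → p ⊕ k ⊗ n ⊕ conℕ 0 ⊕ k ⊜ p ⊕ k ⊗ (conℕ 1 ⊕ n)) ≡.refl p k n) ⟩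
      + (p ℕ.+ k ℕ.* m) ∎

    drop : ∀ {a b} → + a ≤ℤ + b → a ≤ b
    drop (ℤ.+≤+ a≤b) = a≤b

  singularProbability-value : p ≤ n → ∀ {N} → (∀ i j → subscript (arithmeticPartition p n W) i j ≤ℤ + N) →
    singularProbability F (arithmeticPartition p n W) N ≡ 1ℚ - eulerProduct q {{order-nonZero}} n
  singularProbability-value p≤n {N} bound
    -- `h + p` is `W - 1`, the number of rows above the bottom one.
    with ℕ.m≤n⇒∃[o]m+o≡n (lastSubscript {k = h ℕ.+ p} (≡.trans (≡.sym (ℕ.+-suc h p)) h+p) bound)
  ... | rest , ≡.refl = proportion-complement singular? (tuples N) regular {eulerProduct q n}
    (≡.subst NonZero (≡.sym (length-tuples N)) (ℕ.m^n≢0 q N))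
    (begin
      length (filter singular? (tuples N)) ℕ.+ regular
        ≡⟨ ≡.cong (ℕ._+ regular) (≡.trans (length-filter-sum singular? (tuples N))
             (sum-tuples N (indicator ∘ singular?) (indicator ∘ minor≟0) minor-respects
               λ v → indicator-cong (singular? v) (minor≟0 (padded commutativeRing v))
                 (K.trans (K.sym (det≈minor-rows _))) (K.trans (det≈minor-rows _)))) ⟩
      sumF^ N (indicator ∘ minor≟0) ℕ.+ regular
        ≡⟨ sumF^-¬ minor≟0 N ⟩
      q ℕ.^ N
        ≡⟨ length-tuples N ⟨
      length (tuples N) ∎)
    -- Multiplying by `Q` clears the denominators of the Euler product; it is cancelled at the end.
    (≡.trans (≡.cong (λ s → eulerProduct q n ℚ.* fromNat s) (length-tuples N)) (fromNat-cancel Q (begin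
      eulerProduct q n ℚ.* fromNat (q ℕ.^ N) ℚ.* fromNat Q
        ≡⟨ solve 3 (λ a b c → (a :* b) :* c := (a :* c) :* b) ≡.refl
             (eulerProduct q n) (fromNat (q ℕ.^ N)) (fromNat Q) ⟩
      eulerProduct q n ℚ.* fromNat Q ℚ.* fromNat (q ℕ.^ N)
        ≡⟨ ≡.cong (ℚ._* fromNat (q ℕ.^ N)) (eulerProduct-* q n (ℕ.n≤1+n n)) ⟩
      fromNat (admissible q m n) ℚ.* fromNat (q ℕ.^ N)
        ≡⟨ fromNat-* (admissible q m n) (q ℕ.^ N) ⟨
      fromNat (admissible q m n ℕ.* q ℕ.^ N)
        ≡⟨ ≡.cong fromNat counted ⟨
      fromNat (regular ℕ.* Q)
        ≡⟨ fromNat-* regular Q ⟩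
      fromNat regular ℚ.* fromNat Q ∎)))
    where
    open ≡-Reasoning
    open Tuples F
    k = h ℕ.+ p
    Q = q ℕ.^ (n ℕ.* m)
    regular = sumF^ N (λ z → nonsingular (rows (delayed h z) W))

    instance
      q≢0 : NonZero q
      q≢0 = order-nonZero

      Q≢0 : NonZero Q
      Q≢0 = ℕ.m^n≢0 q (n ℕ.* m)

    singular? : ∀ (v : Vec Carrier N) → Dec (det commutativeRing (jacobiTrudiAt (padded commutativeRing v)) ≈ 0#)
    singular? v = det commutativeRing (jacobiTrudiAt (padded commutativeRing v)) ≟ 0#

    minor≟0 : ∀ (z : Seq) → Dec (minor (rows (delayed h z) W) columns ≈ 0#)
    minor≟0 z = minor (rows (delayed h z) W) columns ≟ 0#

    minor-respects : Respects (W ℕ.* m ℕ.+ W) (indicator ∘ minor≟0)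
    minor-respects {u} {v} u≐v = indicator-cong (minor≟0 u) (minor≟0 v)
      (K.trans (K.sym same)) (K.trans same)
      where
      same = minor-cong (rows-cong W (delayed-cong h u≐v)
        (ℕ.≤-trans (ℕ.n≤1+n _) (ℕ.m≤n+m (suc (W ℕ.* m ℕ.+ W)) h))) columns<W

    counted : regular ℕ.* Q ≡ admissible q m n ℕ.* q ℕ.^ N
    counted = ≡.subst (λ N → sumF^ N (λ z → nonsingular (rows (delayed h z) W)) ℕ.* Q ≡ admissible q m n ℕ.* q ℕ.^ N)
      (≡.sym (ℕ.+-assoc p (k ℕ.* m) rest))
      (nonsingular-count rest (≡.trans (≡.sym (ℕ.+-suc h p)) h+p) p≤n)

theorem1p1 : ∀ {c ℓ} (q : ℕ) (F : FiniteField c ℓ q) (p n k : ℕ) →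
    0 < p → p ≤ n → n < k →
    (N : ℕ) → (∀ i j → subscript (arithmeticPartition p n k) i j ≤ℤ + N) →
    singularProbability F (arithmeticPartition p n k) N
    ≡ 1ℚ - eulerProduct q {{FiniteField.order-nonZero F}} n
theorem1p1 q F p n k _ p≤n n<k N = value (ℕ.m∸n+n≡m n<k)
  where
  value : ∀ {l k} → l ℕ.+ suc n ≡ k → (∀ i j → subscript (arithmeticPartition p n k) i j ≤ℤ + N) →
          singularProbability F (arithmeticPartition p n k) N
            ≡ 1ℚ - eulerProduct q {{FiniteField.order-nonZero F}} n
  -- `l` is k - (n + 1), which `n < k` permits. Matching writes `k` as `l + suc n`, the form of the
  -- matrix size in `JacobiTrudi`.
  value {l} ≡.refl = JacobiTrudi.singularProbability-value F l n p (l ℕ.+ suc n ℕ.∸ suc p)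
    (ℕ.m∸n+n≡m (ℕ.≤-trans (s≤s p≤n) (ℕ.m≤n+m (suc n) l))) p≤n
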